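{- Let $N$ be an odd prime, $\zeta=e^{2\pi i/N}$, $O=\mathbb{Z}[\zeta]$, and let $\beta\in O$ be binary. Then $$\mathcal{N}(\beta)\le\left(\frac{N+1}{4}\right)^{\frac{N-1}{2}},$$ and equality holds only if $\beta$ is perfect.
   Context: Elements of $O$ are written in the basis $\zeta,\dots,\zeta^{N-1}$ as $\alpha=\sum_{i=1}^{N-1}[\alpha]_i\zeta^i$. An element $\beta\in O$ is binary if $\beta\neq0$ and either all coordinates $[\beta]_i$ lie in $\{0,1\}$ or all lie in $\{ -1,0\}$. For $1\le j\le N-1$, $\sigma_j$ is the automorphism of $O$ with $\sigma_j(\zeta)=\zeta^j$. The norm is $\mathcal{N}(\alpha)=\prod_{j=1}^{N-1}\sigma_j(\alpha)=\prod_{j=1}^{(N-1)/2}|\sigma_j(\alpha)|^2\in\mathbb{Z}$. A binary $\beta\in O$ is perfect if $\beta\overline{\beta}\in\mathbb{Z}$, where the overbar is complex conjugation ($\zeta\mapsto\zeta^{ -1}$). -}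

module Defs where

open import Data.Nat as ℕ using (ℕ; zero; suc; NonZero)
open import Data.Nat.DivMod using (_mod_)
open import Data.Fin as Fin using (Fin; toℕ)
open import Data.List using (List; map; foldr; allFin; upTo)
open import Data.Integer as ℤ using (ℤ; +_; -_; _-_; 0ℤ; 1ℤ)
open import Data.Product using (∃; _×_; _,_)
open import Data.Sum using (_⊎_)
open import Relation.Binary.PropositionalEquality using (_≡_; _≢_)
open import Relation.Nullary using (¬_; does)
open import Data.Bool using (if_then_else_)
open import Data.Fin using (_≟_)

sumFin : (n : ℕ) → (Fin n → ℤ) → ℤ
sumFin n f = foldr ℤ._+_ 0ℤ (map f (allFin n))

-- Fix N.  The group ring Z[C_N] = Z[x]/(x^N - 1): an element is its coefficient
-- vector a : Fin N → ℤ, representing Σ_k a k x^k.  The ring O = Z[ζ] is the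
-- quotient Z[C_N]/(1 + x + ... + x^{N-1}) = Z[C_N]/{constant vectors}.
module _ (N : ℕ) .{{_ : NonZero N}} where

  GR : Set
  GR = Fin N → ℤ

  ix : ℕ → Fin N
  ix k = k mod N

  mono : ℤ → ℕ → GR
  mono c e k = if does (k ≟ ix e) then c else 0ℤ

  _+G_ : GR → GR → GR
  (a +G b) k = a k ℤ.+ b k

  zeroG : GR
  zeroG _ = 0ℤ

  oneG : GR
  oneG = mono 1ℤ 0

  embed : ℤ → GR
  embed m = mono m 0

  _*G_ : GR → GR → GR
  (a *G b) k = sumFin N (λ i → a i ℤ.* b (ix (toℕ k ℕ.+ (N ℕ.∸ toℕ i))))

  -- σ_j : ζ ↦ ζ^j, i.e. Σ_i a_i x^i ↦ Σ_i a_i x^{ij}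
  σ : ℕ → GR → GR
  σ j a k = sumFin N (λ i → if does (k ≟ ix (toℕ i ℕ.* j)) then a i else 0ℤ)

  conj : GR → GR
  conj a k = a (ix (N ℕ.∸ toℕ k))

  -- equality in O = Z[ζ]: the difference lies in the kernel of Z[C_N] → Z[ζ],
  -- which is the set of constant vectors (multiples of 1 + x + ... + x^{N-1}).
  _≈O_ : GR → GR → Set
  a ≈O b = ∀ i j → a i - b i ≡ a j - b j

  normProd : GR → GR
  normProd a = foldr (λ j acc → σ (suc j) a *G acc) oneG (upTo (N ℕ.∸ 1))

  IsNorm : GR → ℤ → Set
  IsNorm a m = normProd a ≈O embed m

  -- β given by its coordinates in the basis ζ, …, ζ^{N-1}:
  -- β = Σ_{i=1}^{N-1} b_i ζ^i, encoded as b : Fin N → ℤ with b 0 = 0.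
  Coords : GR → Set
  Coords b = b (ix 0) ≡ 0ℤ

  Binary : GR → Set
  Binary b = (∃ λ i → b i ≢ 0ℤ)
           × ((∀ i → (b i ≡ 0ℤ ⊎ b i ≡ 1ℤ)) ⊎ (∀ i → (b i ≡ - 1ℤ ⊎ b i ≡ 0ℤ)))

  Perfect : GR → Set
  Perfect b = ∃ λ (c : ℤ) → (b *G conj b) ≈O embed c

{-# OPTIONS --safe #-}
module Submission where

-- Put x_j = |σ_j β|². The trace is a functional on Z[ζ] which is nonnegative on every η η̄, and
-- (up to a positive integer factor) the gap in AM-GM for x_1, …, x_{N-1} is built from elements
-- η η̄ by sums and products, so AM-GM holds under the trace without real embeddings. Since N is
-- prime, Σ_j x_j is the integer N Σ b_i² - (Σ b_i)², which for binary β equals N t - t² with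
-- t = Σ b_i², hence is at most (N² - 1)/4; the product is N(β)², and AM-GM gives the square of the
-- claimed bound. In the equality case the gap has trace 0, which forces (N - 1) x_1 to equal the
-- integer Σ_j x_j, so β β̄ is an integer.

open import Algebra using (AbelianGroup; CommutativeRing)
open import Data.Integer as ℤ using (ℤ; +_; 0ℤ; 1ℤ)
import Data.Integer.Properties as ℤ
open import Data.List using (List; []; _∷_; foldr; length; tabulate; upTo; applyUpTo)
open import Data.List.Properties using (length-applyUpTo; map-tabulate)
open import Data.Nat as ℕ using (ℕ; zero; suc; NonZero)
import Data.Nat.Properties as ℕ
open import Data.Product using (∃; ∃₂; _×_; _,_; proj₁; proj₂)
open import Level using (0ℓ)
open import Relation.Binary.PropositionalEquality as ≡ using (_≡_)
import Algebra.Properties.AbelianGroup as AbelianGroupProperties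
import Algebra.Properties.CommutativeSemiring.Exp as Exp
import Algebra.Properties.Ring as RingProperties
import Algebra.Properties.Semiring.Mult as Mult
import Algebra.Solver.Ring.NaturalCoefficients.Default as Solver
import Relation.Binary.Reasoning.Setoid as SetoidReasoning

-- The ring carries no order, so AM-GM must be an identity: the larger side is the smaller one plus
-- an explicit positive gap, and only the trace turns this into an inequality. The gap grows by
-- induction on the number of terms. If x joins m terms with sum S, put A = x + S, p = mA, q =
-- (m+1)S. Then p/q is the ratio of the new mean to the old one and p - q = mx - S. Bernoulli's
-- inequality p^(m+1) + m q^(m+1) ≥ (m+1) p q^m is the induction step, with a gap that contains
-- p^(m-1) (p - q)². Denominators are cleared instead of divided out, which costs only positive
-- integer factors. In the last step A is the integer sum, so p^(m-1) is an integer as well. If it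
-- is nonzero, a gap of trace 0 forces tr((mx - S)²) = 0, and definiteness gives mx = S. The
-- constant (N+1)/4 is the largest possible mean: (N² - 1)/4 divided by the N - 1 conjugates.

private module ℤ+ = AbelianGroupProperties ℤ.+-0-abelianGroup

-- AM-GM under a positive trace

ℤ+-cancelˡ-≤ : ∀ i j k → i ℤ.+ j ℤ.≤ i ℤ.+ k → j ℤ.≤ k
ℤ+-cancelˡ-≤ i j k i+j≤i+k = ≡.subst₂ ℤ._≤_ (ℤ+.\\-leftDividesʳ i j) (ℤ+.\\-leftDividesʳ i k)
  (ℤ.+-monoʳ-≤ (ℤ.- i) i+j≤i+k)

-- What AM-GM needs to know about Z[ζ]. All inequalities are between integer values of `tr`.
record PositiveStarRing : Set₁ where
  field
    commutativeRing : CommutativeRing 0ℓ 0ℓ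
  open CommutativeRing commutativeRing public
  field
    conj            : Carrier → Carrier
    conj-cong       : ∀ {a b} → a ≈ b → conj a ≈ conj b
    conj-+          : ∀ a b → conj (a + b) ≈ conj a + conj b
    conj-*          : ∀ a b → conj (a * b) ≈ conj a * conj b
    conj-neg        : ∀ a → conj (- a) ≈ - conj a
    conj-1          : conj 1# ≈ 1#
    conj-involutive : ∀ a → conj (conj a) ≈ a
    tr              : Carrier → ℤ
    tr-cong         : ∀ {a b} → a ≈ b → tr a ≡ tr b
    tr-+            : ∀ a b → tr (a + b) ≡ tr a ℤ.+ tr b
    tr-1-positive   : ℤ.Positive (tr 1#)
    tr-norm-nonneg  : ∀ a → 0ℤ ℤ.≤ tr (a * conj a)
    tr-definite     : ∀ a → tr (a * conj a) ℤ.≤ 0ℤ → a ≈ 0#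

module PositiveStarRingProperties (R : PositiveStarRing) where
  open PositiveStarRing R public
  open Exp commutativeSemiring using (_^_; ^-congˡ; ^-distrib-*) public
  open Mult semiring using (×1-homo-*) renaming (_×_ to _·_)
  open RingProperties ring using (+-cancelʳ; x∙y⁻¹≈ε⇒x≈y)
  open SetoidReasoning setoid
  open Solver commutativeSemiring using (solve; _:+_; _:*_; _:=_)

  -- Natural numbers in the ring and their traces

  ν : ℕ → Carrier
  ν n = n · 1#

  ν-* : ∀ m n → ν (m ℕ.* n) ≈ ν m * ν n
  ν-* = ×1-homo-*

  ν-^ : ∀ m n → ν (m ℕ.^ n) ≈ ν m ^ n
  ν-^ m zero    = +-identityʳ 1#
  ν-^ m (suc n) = trans (ν-* m (m ℕ.^ n)) (*-congˡ (ν-^ m n))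

  suc-* : ∀ w y → (1# + w) * y ≈ y + w * y
  suc-* w y = trans (distribʳ y 1# w) (+-congʳ (*-identityˡ y))

  tr-0 : tr 0# ≡ 0ℤ
  tr-0 = ℤ+.∙-cancelˡ (tr 0#) (tr 0#) 0ℤ
    (≡.trans (≡.sym (tr-+ 0# 0#)) (≡.trans (tr-cong (+-identityˡ 0#)) (≡.sym (ℤ.+-identityʳ (tr 0#)))))

  tr-ν* : ∀ n a → tr (ν n * a) ≡ + n ℤ.* tr a
  tr-ν* zero    a = ≡.trans (tr-cong (zeroˡ a)) tr-0
  tr-ν* (suc n) a = ≡.trans (tr-cong (suc-* (ν n) a)) (≡.trans (tr-+ a (ν n * a))
    (≡.trans (≡.cong (λ t → tr a ℤ.+ t) (tr-ν* n a)) (≡.sym (ℤ.suc-* (+ n) (tr a)))))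

  tr-ν : ∀ n → tr (ν n) ≡ + n ℤ.* tr 1#
  tr-ν n = ≡.trans (tr-cong (sym (*-identityʳ (ν n)))) (tr-ν* n 1#)

  ν-mono-≤ : ∀ {m n} → m ℕ.≤ n → tr (ν m) ℤ.≤ tr (ν n)
  ν-mono-≤ {m} {n} m≤n = ≡.subst₂ ℤ._≤_ (≡.sym (tr-ν m)) (≡.sym (tr-ν n))
    (ℤ.*-monoʳ-≤-nonNeg (tr 1#) {{ℤ.nonNegative (ℤ.<⇒≤ (ℤ.positive⁻¹ (tr 1#) {{tr-1-positive}}))}} (ℤ.+≤+ m≤n))

  -- `tr 1#` need not be 1 (in Z[ζ] it is N - 1), but it is positive, so the trace reflects the
  -- order of integers.
  ν-cancel-≤ : ∀ {m n} → tr (ν m) ℤ.≤ tr (ν n) → m ℕ.≤ n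
  ν-cancel-≤ {m} {n} le = ℤ.drop‿+≤+ (ℤ.*-cancelʳ-≤-pos (+ m) (+ n) (tr 1#) {{tr-1-positive}}
    (≡.subst₂ ℤ._≤_ (tr-ν m) (tr-ν n) le))

  -- Real and positive elements

  Real : Carrier → Set
  Real a = conj a ≈ a

  real-+ : ∀ {a b} → Real a → Real b → Real (a + b)
  real-+ {a} {b} ra rb = trans (conj-+ a b) (+-cong ra rb)

  real-* : ∀ {a b} → Real a → Real b → Real (a * b)
  real-* {a} {b} ra rb = trans (conj-* a b) (*-cong ra rb)

  real-neg : ∀ {a} → Real a → Real (- a)
  real-neg {a} ra = trans (conj-neg a) (-‿cong ra)

  conj-0 : conj 0# ≈ 0#
  conj-0 = begin
    conj 0#               ≈⟨ conj-cong (-‿inverseʳ 0#) ⟨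
    conj (0# + - 0#)      ≈⟨ conj-+ 0# (- 0#) ⟩
    conj 0# + conj (- 0#) ≈⟨ +-congˡ (conj-neg 0#) ⟩
    conj 0# + - conj 0#   ≈⟨ -‿inverseʳ (conj 0#) ⟩
    0#                    ∎

  real-ν : ∀ n → Real (ν n)
  real-ν zero    = conj-0
  real-ν (suc n) = real-+ conj-1 (real-ν n)

  real-norm : ∀ a → Real (a * conj a)
  real-norm a = trans (conj-* a (conj a)) (trans (*-congˡ (conj-involutive a)) (*-comm (conj a) a))

  TraceNonneg : Carrier → Set
  TraceNonneg a = ∀ η → 0ℤ ℤ.≤ tr (a * (η * conj η))

  -- Preserving TraceNonneg, rather than satisfying it, makes closure under products immediate.
  Pos : Carrier → Set
  Pos r = ∀ a → TraceNonneg a → TraceNonneg (r * a)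

  pos-resp : ∀ {r s} → r ≈ s → Pos r → Pos s
  pos-resp r≈s pr a ta η = ≡.subst (0ℤ ℤ.≤_) (tr-cong (*-congʳ (*-congʳ r≈s))) (pr a ta η)

  pos-+ : ∀ {r s} → Pos r → Pos s → Pos (r + s)
  pos-+ {r} {s} pr ps a ta η = ≡.subst (0ℤ ℤ.≤_)
    (≡.sym (≡.trans (tr-cong (solve 4 (λ r s a h → (r :+ s) :* a :* h := r :* a :* h :+ s :* a :* h) refl r s a (η * conj η)))
                    (tr-+ _ _)))
    (ℤ.+-mono-≤ (pr a ta η) (ps a ta η))

  pos-* : ∀ {r s} → Pos r → Pos s → Pos (r * s)
  pos-* {r} {s} pr ps a ta η = ≡.subst (0ℤ ℤ.≤_)
    (tr-cong (*-congʳ (sym (*-assoc r s a)))) (pr (s * a) (ps a ta) η)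

  -- The factor ξ ξ̄ is absorbed by the test element: ξ ξ̄ η η̄ is the norm of ξη.
  pos-norm : ∀ ξ → Pos (ξ * conj ξ)
  pos-norm ξ a ta η = ≡.subst (0ℤ ℤ.≤_) (tr-cong eq) (ta (ξ * η))
    where
    eq : a * (ξ * η * conj (ξ * η)) ≈ ξ * conj ξ * a * (η * conj η)
    eq = trans (*-congˡ (*-congˡ (conj-* ξ η)))
      (solve 5 (λ a x y z w → a :* (x :* y :* (z :* w)) := x :* z :* a :* (y :* w)) refl a ξ η (conj ξ) (conj η))

  pos-square : ∀ {a} → Real a → Pos (a * a)
  pos-square {a} ra = pos-resp (*-congˡ ra) (pos-norm a)

  pos-0 : Pos 0#
  pos-0 = pos-resp (zeroˡ (conj 0#)) (pos-norm 0#)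

  pos-1 : Pos 1#
  pos-1 = pos-resp (*-identityˡ 1#) (pos-square conj-1)

  pos-ν : ∀ n → Pos (ν n)
  pos-ν zero    = pos-0
  pos-ν (suc n) = pos-+ pos-1 (pos-ν n)

  pos-^ : ∀ {a} → Pos a → ∀ n → Pos (a ^ n)
  pos-^ pa zero    = pos-1
  pos-^ pa (suc n) = pos-* pa (pos-^ pa n)

  -- `1#` is itself `TraceNonneg`, so testing `Pos r` at a = η = 1 reads off the trace of r.
  tr-nonneg : ∀ {r} → Pos r → 0ℤ ℤ.≤ tr r
  tr-nonneg {r} pr = ≡.subst (0ℤ ℤ.≤_) (tr-cong eq) (pr 1# (λ η → ≡.subst (0ℤ ℤ.≤_)
      (tr-cong (sym (*-identityˡ _))) (tr-norm-nonneg η)) 1#)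
    where
    eq : r * 1# * (1# * conj 1#) ≈ r
    eq = trans (*-cong (*-identityʳ r) (trans (*-identityˡ _) conj-1)) (*-identityʳ r)

  -- p^(n+2) + (n+1) q^(n+2) - (n+2) p q^(n+1) is divisible by (p - q)², and the quotient
  -- has nonnegative coefficients; the term p^n (p - q)² is kept apart for the equality case.
  module Bernoulli (p q d : Carrier) (p≈q+d : p ≈ q + d) where

    -- Unfolded, the sum over 1 ≤ i ≤ n of (i+1) q^i p^(n-i) d²; the term i = 0 is the one kept
    -- apart.
    remainder : ℕ → Carrier
    remainder zero    = 0#
    remainder (suc n) = p * remainder n + ν (2 ℕ.+ n) * q ^ (1 ℕ.+ n) * (d * d)

    pos-remainder : Pos p → Pos q → Pos (d * d) → ∀ n → Pos (remainder n)
    pos-remainder pp pq pd zero    = pos-0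
    pos-remainder pp pq pd (suc n) = pos-+ (pos-* pp (pos-remainder pp pq pd n))
      (pos-* (pos-* (pos-ν (2 ℕ.+ n)) (pos-^ pq (1 ℕ.+ n))) pd)

    sum-of-squares : p * p + q * q ≈ d * d + (p * q + p * q)
    sum-of-squares = trans (+-congʳ (*-cong p≈q+d p≈q+d)) (trans
      (solve 2 (λ q d → (q :+ d) :* (q :+ d) :+ q :* q := d :* d :+ ((q :+ d) :* q :+ (q :+ d) :* q)) refl q d)
      (+-congˡ (+-cong (*-congʳ (sym p≈q+d)) (*-congʳ (sym p≈q+d)))))

    -- With `d` given by `p ≈ q + d`, no subtraction occurs, and the polynomial steps are identities
    -- with natural coefficients, within reach of the semiring solver.
    bernoulli : ∀ n → p ^ (2 ℕ.+ n) + ν (1 ℕ.+ n) * q ^ (2 ℕ.+ n)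
                    ≈ p ^ n * (d * d) + remainder n + ν (2 ℕ.+ n) * (p * q ^ (1 ℕ.+ n))
    bernoulli zero = begin
      p * (p * 1#) + (1# + 0#) * (q * (q * 1#))
        ≈⟨ +-cong (*-congˡ (*-identityʳ p)) (trans (*-congʳ (+-identityʳ 1#)) (trans (*-identityˡ _) (*-congˡ (*-identityʳ q)))) ⟩
      p * p + q * q
        ≈⟨ sum-of-squares ⟩
      d * d + (p * q + p * q)
        ≈⟨ +-cong (trans (+-identityʳ _) (*-identityˡ _)) 2pq ⟨
      1# * (d * d) + 0# + (1# + (1# + 0#)) * (p * (q * 1#)) ∎
      where
      2pq : (1# + (1# + 0#)) * (p * (q * 1#)) ≈ p * q + p * q
      2pq = trans (*-cong (+-congˡ (+-identityʳ 1#)) (*-congˡ (*-identityʳ q)))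
                  (trans (suc-* 1# _) (+-congˡ (*-identityˡ _)))
    -- Adding (n+1) p q^(n+2) completes the left side to p times the induction hypothesis. On the
    -- right, 2pq yields two terms (n+2) p q^(n+2): one is split to return the added term, and what
    -- is left raises the other coefficient to n+3.
    bernoulli (suc n) = +-cancelʳ (w * (p * (q * Q))) _ _ (begin
      p * X + u * (q * (q * Q)) + w * (p * (q * Q))
        ≈⟨ solve 6 (λ p q X Q u w → p :* X :+ u :* (q :* (q :* Q)) :+ w :* (p :* (q :* Q))
                     := p :* (X :+ w :* (q :* Q)) :+ u :* (q :* (q :* Q))) refl p q X Q u w ⟩
      p * (X + w * (q * Q)) + u * (q * (q * Q))
        ≈⟨ +-congʳ (*-congˡ (bernoulli n)) ⟩
      p * (P * D + F + u * (p * Q)) + u * (q * (q * Q))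
        ≈⟨ solve 7 (λ p q P D F Q u → p :* (P :* D :+ F :+ u :* (p :* Q)) :+ u :* (q :* (q :* Q))
                     := p :* (P :* D :+ F) :+ u :* Q :* (p :* p :+ q :* q)) refl p q P D F Q u ⟩
      p * (P * D + F) + u * Q * (p * p + q * q)
        ≈⟨ +-congˡ (*-congˡ sum-of-squares) ⟩
      p * (P * D + F) + u * Q * (D + (p * q + p * q))
        ≈⟨ solve 7 (λ p q P D F Q u → p :* (P :* D :+ F) :+ u :* Q :* (D :+ (p :* q :+ p :* q))
                     := p :* P :* D :+ (p :* F :+ u :* Q :* D) :+ (u :* (p :* (q :* Q)) :+ u :* (p :* (q :* Q)))) refl p q P D F Q u ⟩
      p * P * D + (p * F + u * Q * D) + (u * (p * (q * Q)) + u * (p * (q * Q)))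
        ≈⟨ +-congˡ (+-congˡ (suc-* w (p * (q * Q)))) ⟩
      p * P * D + (p * F + u * Q * D) + (u * (p * (q * Q)) + (p * (q * Q) + w * (p * (q * Q))))
        ≈⟨ solve 4 (λ a b y c → a :+ (b :+ (y :+ c)) := a :+ (y :+ b) :+ c) refl _ _ _ _ ⟩
      p * P * D + (p * F + u * Q * D) + (p * (q * Q) + u * (p * (q * Q))) + w * (p * (q * Q))
        ≈⟨ +-congʳ (+-congˡ (suc-* u (p * (q * Q)))) ⟨
      p * P * D + (p * F + u * Q * D) + (1# + u) * (p * (q * Q)) + w * (p * (q * Q)) ∎)
      where
      X = p ^ (2 ℕ.+ n)
      Q = q ^ (1 ℕ.+ n)
      P = p ^ n
      D = d * d
      F = remainder n
      w = ν (1 ℕ.+ n)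
      u = ν (2 ℕ.+ n)

  -- AM-GM for norms, by induction on their number

  module AMGM {I : Set} (h : I → Carrier) where

    sumNorms : List I → Carrier
    sumNorms = foldr (λ j s → h j * conj (h j) + s) 0#

    productNorms : List I → Carrier
    productNorms = foldr (λ j s → h j * conj (h j) * s) 1#

    -- When the `h j` are the conjugates of β, π is the norm of β, so the product of the x_j becomes
    -- the square of an integer.
    productNorms≈norm : ∀ js → let π = foldr (λ j s → h j * s) 1# js in productNorms js ≈ π * conj π
    productNorms≈norm []       = sym (trans (*-congˡ conj-1) (*-identityˡ 1#))
    productNorms≈norm (j ∷ js) = begin
      h j * conj (h j) * productNorms js ≈⟨ *-congˡ (productNorms≈norm js) ⟩
      h j * conj (h j) * (π * conj π)    ≈⟨ solve 4 (λ a b c d → a :* b :* (c :* d) := a :* c :* (b :* d)) refl _ _ _ _ ⟩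
      h j * π * (conj (h j) * conj π)    ≈⟨ *-congˡ (conj-* (h j) π) ⟨
      h j * π * conj (h j * π)           ∎
      where π = foldr (λ j s → h j * s) 1# js

    real-sumNorms : ∀ js → Real (sumNorms js)
    real-sumNorms []       = conj-0
    real-sumNorms (j ∷ js) = real-+ (real-norm (h j)) (real-sumNorms js)

    pos-sumNorms : ∀ js → Pos (sumNorms js)
    pos-sumNorms []       = pos-0
    pos-sumNorms (j ∷ js) = pos-+ (pos-norm (h j)) (pos-sumNorms js)

    -- A certificate for n^n Π ≤ S^n, up to the positive factor k.
    Certificate : List I → Set
    Certificate js = ∃₂ λ k c → NonZero k × Pos c ×
      (ν k * sumNorms js ^ n ≈ ν k * (ν n ^ n * productNorms js) + c)
      where n = length js

    -- The head minus the mean of the tail, multiplied by the length of the tail to stay in the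
    -- ring.
    deviation : I → List I → Carrier
    deviation j js = ν (length js) * (h j * conj (h j)) + - sumNorms js

    real-deviation : ∀ j js → Real (deviation j js)
    real-deviation j js = real-+ (real-* (real-ν (length js)) (real-norm (h j))) (real-neg (real-sumNorms js))

    -- The separate term p^n (p - q)² of the Bernoulli identity, at p = mA and p - q = `deviation`.
    defect : I → I → List I → Carrier
    defect j i is = (ν (length js) * sumNorms (j ∷ js)) ^ length is * (deviation j js * deviation j js)
      where js = i ∷ is

    pos-defect : ∀ j i is → Pos (defect j i is)
    pos-defect j i is = pos-* (pos-^ (pos-* (pos-ν (length (i ∷ is))) (pos-sumNorms (j ∷ i ∷ is))) (length is))
      (pos-square (real-deviation j (i ∷ is)))

    StrictCertificate : I → I → List I → Set
    StrictCertificate j i is = ∃₂ λ k l → ∃ λ c → NonZero k × NonZero l × Pos c ×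
      (ν k * sumNorms js ^ n ≈ ν k * (ν n ^ n * productNorms js) + (ν l * defect j i is + c))
      where
      js = j ∷ i ∷ is
      n = length js

    strict⇒certificate : ∀ j i is → StrictCertificate j i is → Certificate (j ∷ i ∷ is)
    strict⇒certificate j i is (k , l , c , k≢0 , _ , pc , eq) =
      k , ν l * defect j i is + c , k≢0 , pos-+ (pos-* (pos-ν l) (pos-defect j i is)) pc , eq

    -- Bernoulli for the ratio of the means says (A/(m+1))^(m+1) ≥ x (S/m)^m; the certificate of the
    -- tail then bounds S^m below by m^m Π.
    strictCertificate : ∀ j i is → Certificate (i ∷ is) → StrictCertificate j i is
    strictCertificate j i is (k , c , k≢0 , pc , eq) =
      -- The factor m^(m+1) is the one in p^(m+1) = m^(m+1) A^(m+1), and k is inherited from the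
      -- tail. The last witness adds the Bernoulli remainder to the tail's gap c, scaled by the
      -- coefficient m (m+1)^(m+1) x that multiplies S^m.
      k ℕ.* m ℕ.^ suc m , k , ν k * F + a * u ^ suc m * x * c ,
      ℕ.m*n≢0 k (m ℕ.^ suc m) {{k≢0}} {{ℕ.m^n≢0 m (suc m)}} , k≢0 ,
      pos-+ (pos-* (pos-ν k) (pos-remainder pos-p pos-q (pos-square (real-deviation j js)) (length is)))
            (pos-* (pos-* (pos-* (pos-ν m) (pos-^ (pos-ν (suc m)) (suc m))) (pos-norm (h j))) pc) ,
      (begin
        ν (k ℕ.* m ℕ.^ suc m) * A ^ suc m
          ≈⟨ *-congʳ scale ⟩
        ν k * a ^ suc m * A ^ suc m
          ≈⟨ *-assoc _ _ _ ⟩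
        ν k * (a ^ suc m * A ^ suc m)
          ≈⟨ *-congˡ expand ⟩
        ν k * (Δ + F + a * u * x * (u ^ m * S ^ m))
          ≈⟨ solve 8 (λ k Δ F a u x U s → k :* (Δ :+ F :+ a :* u :* x :* (U :* s))
                       := k :* Δ :+ k :* F :+ a :* (u :* U) :* x :* (k :* s)) refl (ν k) Δ F a u x (u ^ m) (S ^ m) ⟩
        ν k * Δ + ν k * F + a * u ^ suc m * x * (ν k * S ^ m)
          ≈⟨ +-congˡ (*-congˡ eq) ⟩
        ν k * Δ + ν k * F + a * u ^ suc m * x * (ν k * (a ^ m * Π) + c)
          ≈⟨ solve 9 (λ k Δ F a M V x Π c → k :* Δ :+ k :* F :+ a :* V :* x :* (k :* (M :* Π) :+ c)
                       := k :* (a :* M) :* (V :* (x :* Π)) :+ (k :* Δ :+ (k :* F :+ a :* V :* x :* c)))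
               refl (ν k) Δ F a (a ^ m) (u ^ suc m) x Π c ⟩
        ν k * a ^ suc m * (u ^ suc m * (x * Π)) + (ν k * Δ + (ν k * F + a * u ^ suc m * x * c))
          ≈⟨ +-congʳ (*-congʳ scale) ⟨
        ν (k ℕ.* m ℕ.^ suc m) * (u ^ suc m * (x * Π)) + (ν k * Δ + (ν k * F + a * u ^ suc m * x * c)) ∎)
      where
      js = i ∷ is
      m = length js
      x = h j * conj (h j)
      S = sumNorms js
      Π = productNorms js
      A = x + S
      a = ν m
      u = ν (suc m)
      p = a * A
      q = u * S
      d = deviation j js
      Δ = defect j i is

      p≈q+d : p ≈ q + d
      p≈q+d = begin
        a * (x + S)                        ≈⟨ distribˡ a x S ⟩
        a * x + a * S                      ≈⟨ +-congʳ (trans (+-congˡ (-‿inverseʳ S)) (+-identityʳ (a * x))) ⟨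
        a * x + (S + - S) + a * S          ≈⟨ solve 4 (λ b c s t → b :+ (s :+ t) :+ c := s :+ c :+ (b :+ t)) refl (a * x) (a * S) S (- S) ⟩
        S + a * S + (a * x + - S)          ≈⟨ +-congʳ (suc-* a S) ⟨
        (1# + a) * S + (a * x + - S)       ∎

      open Bernoulli p q d p≈q+d

      F = remainder (length is)

      pos-p : Pos p
      pos-p = pos-* (pos-ν m) (pos-sumNorms (j ∷ js))

      pos-q : Pos q
      pos-q = pos-* (pos-ν (suc m)) (pos-sumNorms js)

      scale : ν (k ℕ.* m ℕ.^ suc m) ≈ ν k * a ^ suc m
      scale = trans (ν-* k (m ℕ.^ suc m)) (*-congˡ (ν-^ m (suc m)))

      expand : a ^ suc m * A ^ suc m ≈ Δ + F + a * u * x * (u ^ m * S ^ m)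
      -- Since p = a(x + S) and uS = q, the term u p q^m splits into a u x q^m and a q^(m+1); the
      -- latter cancels against the left side of Bernoulli.
      expand = +-cancelʳ (a * q ^ suc m) _ _ (begin
        a ^ suc m * A ^ suc m + a * q ^ suc m      ≈⟨ +-congʳ (^-distrib-* a A (suc m)) ⟨
        p ^ suc m + a * q ^ suc m                  ≈⟨ bernoulli (length is) ⟩
        Δ + F + u * (a * (x + S) * q ^ m)          ≈⟨ solve 6 (λ e u a x S Q → e :+ u :* (a :* (x :+ S) :* Q)
                                                         := e :+ a :* u :* x :* Q :+ a :* (u :* S :* Q)) refl (Δ + F) u a x S (q ^ m) ⟩
        Δ + F + a * u * x * q ^ m + a * q ^ suc m  ≈⟨ +-congʳ (+-congˡ (*-congˡ (^-distrib-* u S m))) ⟩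
        Δ + F + a * u * x * (u ^ m * S ^ m) + a * q ^ suc m ∎)

    certificate : ∀ js → Certificate js
    certificate []           = 1 , 0# , _ , pos-0 , trans (*-congˡ (sym (*-identityˡ 1#))) (sym (+-identityʳ _))
    -- A second base case: the exponent in `defect` is the tail length minus one, so the induction
    -- step needs a nonempty tail.
    certificate (j ∷ [])     = 1 , 0# , _ , pos-0 , trans (*-congˡ (begin
      (x + 0#) * 1#            ≈⟨ *-congʳ (+-identityʳ x) ⟩
      x * 1#                   ≈⟨ *-identityˡ (x * 1#) ⟨
      1# * (x * 1#)            ≈⟨ *-congʳ (trans (*-identityʳ _) (+-identityʳ 1#)) ⟨
      (1# + 0#) * 1# * (x * 1#) ∎)) (sym (+-identityʳ _))
      where x = h j * conj (h j)
    certificate (j ∷ i ∷ is) =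
      strict⇒certificate j i is (strictCertificate j i is (certificate (i ∷ is)))

    Bound : I → I → List I → Set
    Bound j i is = tr (ν n ^ n * productNorms js) ℤ.≤ tr (sumNorms js ^ n)
                 × (tr (sumNorms js ^ n) ℤ.≤ tr (ν n ^ n * productNorms js) → tr (defect j i is) ℤ.≤ 0ℤ)
      where
      js = j ∷ i ∷ is
      n = length js

    -- The factors k and l are divided out only here, after taking traces, where positive integers
    -- can be cancelled.
    strictCertificate⇒bound : ∀ j i is → StrictCertificate j i is → Bound j i is
    strictCertificate⇒bound j i is (suc k , suc l , c , _ , _ , pc , eq) = lower , λ upper → ℤ.*-cancelˡ-≤-pos _ _ (+ suc l)
            (ℤ.≤-trans (ℤ.≤-trans (ℤ.i≤i+j _ _ {{ℤ.nonNegative (tr-nonneg pc)}})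
                                  (ℤ.≤-reflexive (≡.sym tr-gap)))
                       (ℤ.≤-trans (gap≤0 upper) (ℤ.≤-reflexive (≡.sym (ℤ.*-zeroʳ (+ suc l))))))
      where
      js = j ∷ i ∷ is
      n = length js
      Y = ν n ^ n * productNorms js
      Z = sumNorms js ^ n
      gap = ν (suc l) * defect j i is + c

      tr-eq : + suc k ℤ.* tr Z ≡ + suc k ℤ.* tr Y ℤ.+ tr gap
      tr-eq = ≡.trans (≡.sym (tr-ν* (suc k) Z)) (≡.trans (tr-cong eq)
        (≡.trans (tr-+ _ _) (≡.cong (λ t → t ℤ.+ tr gap) (tr-ν* (suc k) Y))))

      tr-gap : tr gap ≡ + suc l ℤ.* tr (defect j i is) ℤ.+ tr c
      tr-gap = ≡.trans (tr-+ _ _) (≡.cong (λ t → t ℤ.+ tr c) (tr-ν* (suc l) _))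

      lower : tr Y ℤ.≤ tr Z
      lower = ℤ.*-cancelˡ-≤-pos _ _ (+ suc k) (ℤ.≤-trans
        (ℤ.i≤i+j _ _ {{ℤ.nonNegative (tr-nonneg (pos-+ (pos-* (pos-ν (suc l)) (pos-defect j i is)) pc))}})
        (ℤ.≤-reflexive (≡.sym tr-eq)))

      gap≤0 : tr Z ℤ.≤ tr Y → tr gap ℤ.≤ 0ℤ
      gap≤0 upper = ℤ+-cancelˡ-≤ (+ suc k ℤ.* tr Y) _ _ (ℤ.≤-trans (ℤ.≤-reflexive (≡.sym tr-eq))
        (ℤ.≤-trans (ℤ.*-monoˡ-≤-nonNeg (+ suc k) upper) (ℤ.≤-reflexive (≡.sym (ℤ.+-identityʳ _)))))

    amgm : ∀ j i is → Bound j i is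
    amgm j i is = strictCertificate⇒bound j i is (strictCertificate j i is (certificate (i ∷ is)))

    -- If the sum is an integer then the defect is an integer multiple of (deviation)²,
    -- so in the equality case the head is the mean.
    amgm-ν : ∀ j i is {s p} → let js = j ∷ i ∷ is ; n = length js in
             sumNorms js ≈ ν s → productNorms js ≈ ν p →
             n ℕ.^ n ℕ.* p ℕ.≤ s ℕ.^ n
           × (.{{NonZero s}} → s ℕ.^ n ℕ.≤ n ℕ.^ n ℕ.* p → ν n * (h j * conj (h j)) ≈ ν s)
    amgm-ν j i is {s} {p} sum≈s product≈p =
      ν-cancel-≤ (≡.subst₂ ℤ._≤_ (tr-cong power-product) (tr-cong power-sum) (proj₁ (amgm j i is))) ,
      λ s^n≤ → mean≈s (proj₂ (amgm j i is) (≡.subst₂ ℤ._≤_ (≡.sym (tr-cong power-sum)) (≡.sym (tr-cong power-product)) (ν-mono-≤ s^n≤)))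
      where
      js = j ∷ i ∷ is
      n = length js
      m = length (i ∷ is)
      l = length is
      x = h j * conj (h j)
      d = deviation j (i ∷ is)
      S = sumNorms (i ∷ is)

      power-sum : sumNorms js ^ n ≈ ν (s ℕ.^ n)
      power-sum = trans (^-congˡ n sum≈s) (sym (ν-^ s n))

      power-product : ν n ^ n * productNorms js ≈ ν (n ℕ.^ n ℕ.* p)
      power-product = trans (*-cong (sym (ν-^ n n)) product≈p) (sym (ν-* (n ℕ.^ n) p))

      defect≈ : defect j i is ≈ ν ((m ℕ.* s) ℕ.^ l) * (d * conj d)
      defect≈ = *-cong
        (trans (^-congˡ l (trans (*-congˡ sum≈s) (sym (ν-* m s)))) (sym (ν-^ (m ℕ.* s) l)))
        (*-congˡ (sym (real-deviation j (i ∷ is))))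

      mean≈s : .{{_ : NonZero s}} → tr (defect j i is) ℤ.≤ 0ℤ → ν n * x ≈ ν s
      mean≈s defect≤0 = begin
        ν n * x                ≈⟨ suc-* (ν m) x ⟩
        x + ν m * x            ≈⟨ +-congˡ (x∙y⁻¹≈ε⇒x≈y (ν m * x) S d≈0) ⟩
        x + S                  ≈⟨ sum≈s ⟩
        ν s                    ∎
        where
        -- For s = 0 and l > 0 this would vanish and the defect would say nothing about d, hence the
        -- instance `NonZero s`.
        factor = (m ℕ.* s) ℕ.^ l
        factor≢0 : NonZero factor
        factor≢0 = ℕ.m^n≢0 (m ℕ.* s) l {{ℕ.m*n≢0 m s}}
        d≈0 : d ≈ 0#
        d≈0 = tr-definite d (ℤ.*-cancelˡ-≤-pos _ _ (+ factor) {{ℤ.positive (ℤ.+<+ (ℕ.>-nonZero⁻¹ factor {{factor≢0}}))}}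
          (ℤ.≤-trans (ℤ.≤-reflexive (≡.trans (≡.sym (tr-ν* factor (d * conj d))) (≡.sym (tr-cong defect≈))))
            (ℤ.≤-trans defect≤0 (ℤ.≤-reflexive (≡.sym (ℤ.*-zeroʳ (+ factor)))))))

open import Defs
open import Data.Bool using (true; false; if_then_else_)
open import Data.Fin using (Fin; zero; suc; toℕ; punchOut)
open import Data.Fin.Permutation using (Permutation′; permutation)
open import Data.Fin.Properties using (_≟_; any?; fromℕ<-cong; fromℕ<-toℕ; injective⇒≤; punchOut-injective; toℕ-fromℕ<; toℕ<n)
open import Data.Integer.Solver using (module +-*-Solver)
open import Data.Nat.DivMod using (_%_; m%n<n; m%n%n≡m%n; %-distribˡ-+; %-distribˡ-*; m<n⇒m%n≡m; n%n≡0; m≡m%n+[m/n]*n; m*n/n≡m)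
open import Data.Nat.Divisibility using (_∣_; m%n≡0⇒n∣m; n∣m⇒m%n≡0)
open import Data.Nat.Primality using (Prime; euclidsLemma; prime⇒irreducible; ¬prime[1])
import Data.Nat.Solver as ℕSolver
open import Data.Sum using (inj₁; inj₂; [_,_]′)
open import Function using (_∘_; id; mk⇔)
open import Function.Definitions using (Injective)
open import Relation.Binary.PropositionalEquality
open import Relation.Nullary using (does; yes; no; contradiction)
open import Relation.Nullary.Decidable using (dec-true; dec-false; does-⇔)
open import Algebra.Properties.Semiring.Sum ℤ.+-*-semiring
  using (sum; sum-cong-≗; ∑-distrib-+; ∑-comm; *-distribˡ-sum; *-distribʳ-sum; sum-permute)
open ≡-Reasoning

-- The group ring and its quotient Z[ζ]

injective⇒surjective : ∀ {n} {f : Fin n → Fin n} → Injective _≡_ _≡_ f → ∀ k → ∃ λ j → f j ≡ k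
injective⇒surjective {suc n} {f} inj k with any? (λ j → f j ≟ k)
... | yes found = found
... | no ¬found = contradiction
  (injective⇒≤ {f = λ j → punchOut (k≢f j)} (λ {i} {j} eq → inj (punchOut-injective (k≢f i) (k≢f j) eq)))
  ℕ.1+n≰n
  where
  k≢f : ∀ j → k ≢ f j
  k≢f j k≡fj = ¬found (j , sym k≡fj)

injective⇒permutation : ∀ {n} {f : Fin n → Fin n} → Injective _≡_ _≡_ f → Permutation′ n
injective⇒permutation {f = f} inj = permutation f (proj₁ ∘ surj) (proj₂ ∘ surj) (inj ∘ proj₂ ∘ surj ∘ f)
  where surj = injective⇒surjective inj

-- Finite sums of integers

foldr-tabulate : ∀ {n} (f : Fin n → ℤ) → foldr ℤ._+_ 0ℤ (tabulate f) ≡ sum f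
foldr-tabulate {zero}  f = refl
foldr-tabulate {suc n} f = cong (ℤ._+_ (f zero)) (foldr-tabulate (f ∘ suc))

sumFin≡sum : ∀ {n} (f : Fin n → ℤ) → sumFin n f ≡ sum f
sumFin≡sum f = trans (cong (foldr ℤ._+_ 0ℤ) (map-tabulate id f)) (foldr-tabulate f)

sum-const : ∀ n c → sum {n} (λ _ → c) ≡ + n ℤ.* c
sum-const zero    c = sym (ℤ.*-zeroˡ c)
sum-const (suc n) c = trans (cong (ℤ._+_ c) (sum-const n c)) (sym (ℤ.suc-* (+ n) c))

sum-zero : ∀ n → sum {n} (λ _ → 0ℤ) ≡ 0ℤ
sum-zero n = trans (sum-const n 0ℤ) (ℤ.*-zeroʳ (+ n))

sum-neg : ∀ {n} (f : Fin n → ℤ) → sum (λ i → ℤ.- f i) ≡ ℤ.- sum f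
sum-neg f = trans (sum-cong-≗ (λ i → sym (ℤ.-1*i≡-i (f i))))
  (trans (sym (*-distribˡ-sum ℤ.-1ℤ f)) (ℤ.-1*i≡-i (sum f)))

sum-nonneg : ∀ {n} (f : Fin n → ℤ) → (∀ i → 0ℤ ℤ.≤ f i) → 0ℤ ℤ.≤ sum f
sum-nonneg {zero}  f f≥0 = ℤ.≤-refl
sum-nonneg {suc n} f f≥0 = ℤ.+-mono-≤ (f≥0 zero) (sum-nonneg (f ∘ suc) (f≥0 ∘ suc))

term≤sum : ∀ {n} (f : Fin n → ℤ) → (∀ i → 0ℤ ℤ.≤ f i) → ∀ i → f i ℤ.≤ sum f
term≤sum {suc n} f f≥0 zero    = ℤ.≤-trans (ℤ.≤-reflexive (sym (ℤ.+-identityʳ (f zero))))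
  (ℤ.+-monoʳ-≤ (f zero) (sum-nonneg (f ∘ suc) (f≥0 ∘ suc)))
term≤sum {suc n} f f≥0 (suc i) = ℤ.≤-trans (term≤sum (f ∘ suc) (f≥0 ∘ suc) i)
  (ℤ.≤-trans (ℤ.≤-reflexive (sym (ℤ.+-identityˡ _))) (ℤ.+-monoˡ-≤ _ (f≥0 zero)))

sum-single : ∀ {n} (k : Fin n) (f : Fin n → ℤ) → sum (λ i → if does (k ≟ i) then f i else 0ℤ) ≡ f k
sum-single {suc n} zero    f = trans (cong (ℤ._+_ (f zero)) (sum-zero n)) (ℤ.+-identityʳ (f zero))
sum-single {suc n} (suc k) f = trans (ℤ.+-identityˡ _) (sum-single k (f ∘ suc))

does-≟-sym : ∀ {n} (i j : Fin n) → does (i ≟ j) ≡ does (j ≟ i)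
does-≟-sym i j = does-⇔ (mk⇔ sym sym) (i ≟ j) (j ≟ i)

if-* : ∀ c (x y : ℤ) → (if c then x else 0ℤ) ℤ.* y ≡ (if c then x ℤ.* y else 0ℤ)
if-* true  x y = refl
if-* false x y = ℤ.*-zeroˡ y

sum-if : ∀ {n} c (f : Fin n → ℤ) → sum (λ i → if c then f i else 0ℤ) ≡ (if c then sum f else 0ℤ)
sum-if     true  f = refl
sum-if {n} false f = sum-zero n

square-nonneg : ∀ x → 0ℤ ℤ.≤ x ℤ.* x
square-nonneg (+ n)      = ℤ.≤-trans (ℤ.+≤+ ℕ.z≤n) (ℤ.≤-reflexive (ℤ.pos-* n n))
square-nonneg (ℤ.-[1+ n ]) = ℤ.+≤+ ℕ.z≤n

sumRange : ∀ n (f : ℕ → ℤ) g → foldr (λ j s → f j ℤ.+ s) 0ℤ (applyUpTo g n) ≡ sum {n} (λ i → f (g (toℕ i)))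
sumRange zero    f g = refl
sumRange (suc n) f g = cong (ℤ._+_ (f (g 0))) (sumRange n f (g ∘ suc))

module GroupRing (N : ℕ) .{{N≢0 : NonZero N}} where

  -- The additive group of residues modulo N

  infixl 6 _⊕_ _⊝_
  infixl 7 _⊙_

  _⊕_ : Fin N → Fin N → Fin N
  i ⊕ j = ix N (toℕ i ℕ.+ toℕ j)

  0# : Fin N
  0# = ix N 0

  ⊖_ : Fin N → Fin N
  ⊖ i = ix N (N ℕ.∸ toℕ i)

  _⊝_ : Fin N → Fin N → Fin N
  i ⊝ j = i ⊕ (⊖ j)

  toℕ-ix : ∀ m → toℕ (ix N m) ≡ m % N
  toℕ-ix m = toℕ-fromℕ< (m%n<n m N)

  ix-cong : ∀ m n → m % N ≡ n % N → ix N m ≡ ix N n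
  ix-cong m n eq = fromℕ<-cong _ _ eq (m%n<n m N) (m%n<n n N)

  ix-toℕ : ∀ i → ix N (toℕ i) ≡ i
  ix-toℕ i = trans (fromℕ<-cong _ _ (m<n⇒m%n≡m (toℕ<n i)) (m%n<n (toℕ i) N) (toℕ<n i)) (fromℕ<-toℕ i (toℕ<n i))

  ix-+ : ∀ m n → ix N m ⊕ ix N n ≡ ix N (m ℕ.+ n)
  ix-+ m n = trans (cong₂ (λ x y → ix N (x ℕ.+ y)) (toℕ-ix m) (toℕ-ix n))
    (ix-cong _ _ (sym (%-distribˡ-+ m n N)))

  ix-⊕ : ∀ m i → ix N m ⊕ i ≡ ix N (m ℕ.+ toℕ i)
  ix-⊕ m i = trans (cong (ix N m ⊕_) (sym (ix-toℕ i))) (ix-+ m (toℕ i))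

  ⊕-ix : ∀ i m → i ⊕ ix N m ≡ ix N (toℕ i ℕ.+ m)
  ⊕-ix i m = trans (cong (_⊕ ix N m) (sym (ix-toℕ i))) (ix-+ (toℕ i) m)

  ⊕-comm : ∀ i j → i ⊕ j ≡ j ⊕ i
  ⊕-comm i j = cong (ix N) (ℕ.+-comm (toℕ i) (toℕ j))

  ⊕-assoc : ∀ i j k → (i ⊕ j) ⊕ k ≡ i ⊕ (j ⊕ k)
  ⊕-assoc i j k = trans (ix-⊕ _ k) (trans (cong (ix N) (ℕ.+-assoc (toℕ i) (toℕ j) (toℕ k))) (sym (⊕-ix i _)))

  ⊕-identityˡ : ∀ i → 0# ⊕ i ≡ i
  ⊕-identityˡ i = trans (ix-⊕ 0 i) (ix-toℕ i)

  ⊕-identityʳ : ∀ i → i ⊕ 0# ≡ i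
  ⊕-identityʳ i = trans (⊕-comm i 0#) (⊕-identityˡ i)

  ⊖-inverseʳ : ∀ i → i ⊝ i ≡ 0#
  ⊖-inverseʳ i = trans (⊕-ix i _) (trans (cong (ix N) (ℕ.m+[n∸m]≡n (ℕ.<⇒≤ (toℕ<n i))))
    (ix-cong N 0 (trans (n%n≡0 N) (sym (m<n⇒m%n≡m (ℕ.>-nonZero⁻¹ N))))))

  ⊖-inverseˡ : ∀ i → (⊖ i) ⊕ i ≡ 0#
  ⊖-inverseˡ i = trans (⊕-comm (⊖ i) i) (⊖-inverseʳ i)

  residues : AbelianGroup 0ℓ 0ℓ
  residues = record
    { Carrier = Fin N ; _≈_ = _≡_ ; _∙_ = _⊕_ ; ε = 0# ; _⁻¹ = ⊖_
    ; isAbelianGroup = record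
      { isGroup = record
        { isMonoid = record
          { isSemigroup = record
            { isMagma = record { isEquivalence = isEquivalence ; ∙-cong = cong₂ _⊕_ }
            ; assoc = ⊕-assoc }
          ; identity = ⊕-identityˡ , ⊕-identityʳ }
        ; inverse = ⊖-inverseˡ , ⊖-inverseʳ
        ; ⁻¹-cong = cong ⊖_ }
      ; comm = ⊕-comm } }

  open AbelianGroupProperties residues using (inverseˡ-unique; ⁻¹-involutive; ⁻¹-∙-comm; ε⁻¹≈ε; x∙y⁻¹≈ε⇒x≈y; //-rightDividesˡ; //-rightDividesʳ; xyx⁻¹≈y)

  ⊖-⊝ : ∀ i j → ⊖ (i ⊝ j) ≡ j ⊝ i
  ⊖-⊝ i j = trans (sym (⁻¹-∙-comm i (⊖ j))) (trans (cong (⊖ i ⊕_) (⁻¹-involutive j)) (⊕-comm (⊖ i) j))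

  ⊝-⊝ : ∀ i j → i ⊝ (i ⊝ j) ≡ j
  ⊝-⊝ i j = trans (cong (i ⊕_) (⊖-⊝ i j)) (trans (sym (⊕-assoc i j (⊖ i))) (xyx⁻¹≈y i j))

  ⊝-⊕ : ∀ k i j → k ⊝ (i ⊕ j) ≡ (k ⊝ j) ⊝ i
  ⊝-⊕ k i j = trans (cong (k ⊕_) (trans (sym (⁻¹-∙-comm i j)) (⊕-comm (⊖ i) (⊖ j)))) (sym (⊕-assoc k (⊖ j) (⊖ i)))

  sum-⊖ : ∀ (f : Fin N → ℤ) → sum (λ i → f (⊖ i)) ≡ sum f
  sum-⊖ f = sym (sum-permute f (permutation ⊖_ ⊖_ ⁻¹-involutive ⁻¹-involutive))

  sum-⊕ : ∀ (f : Fin N → ℤ) c → sum (λ i → f (i ⊕ c)) ≡ sum f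
  sum-⊕ f c = sym (sum-permute f (permutation (_⊕ c) (_⊝ c) (//-rightDividesˡ c) (//-rightDividesʳ c)))

  sum-⊝ : ∀ (f : Fin N → ℤ) c → sum (λ i → f (c ⊝ i)) ≡ sum f
  sum-⊝ f c = sym (sum-permute f (permutation (c ⊝_) (c ⊝_) (⊝-⊝ c) (⊝-⊝ c)))

  -- Convolution, and equality up to constant vectors

  infixl 7 _⊛_
  infix 4 _≈_

  -- _≈O_ wrapped in a record, so that the two sides can be inferred.
  record _≈_ (a b : GR N) : Set where
    constructor mk≈
    field un≈ : _≈O_ N a b
  open _≈_ public

  _⊛_ : GR N → GR N → GR N
  _⊛_ = _*G_ N

  neg : GR N → GR N
  neg a k = ℤ.- a k

  ⊛-def : ∀ a b k → (a ⊛ b) k ≡ sum (λ i → a i ℤ.* b (k ⊝ i))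
  ⊛-def a b k = trans (sumFin≡sum {N} (λ i → a i ℤ.* b (ix N (toℕ k ℕ.+ (N ℕ.∸ toℕ i))))) (sum-cong-≗ {N} (λ i → cong (λ t → a i ℤ.* b t) (sym (⊕-ix k (N ℕ.∸ toℕ i)))))

  ⊛-comm : ∀ a b k → (a ⊛ b) k ≡ (b ⊛ a) k
  ⊛-comm a b k = begin
    (a ⊛ b) k                                       ≡⟨ ⊛-def a b k ⟩
    sum (λ i → a i ℤ.* b (k ⊝ i))                   ≡⟨ sum-⊝ _ k ⟨
    sum (λ i → a (k ⊝ i) ℤ.* b (k ⊝ (k ⊝ i)))       ≡⟨ sum-cong-≗ (λ i → trans (ℤ.*-comm (a (k ⊝ i)) _) (cong (λ t → b t ℤ.* a (k ⊝ i)) (⊝-⊝ k i))) ⟩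
    sum (λ i → b i ℤ.* a (k ⊝ i))                   ≡⟨ ⊛-def b a k ⟨
    (b ⊛ a) k                                       ∎

  ⊛-assoc : ∀ a b c k → ((a ⊛ b) ⊛ c) k ≡ (a ⊛ (b ⊛ c)) k
  ⊛-assoc a b c k = begin
    ((a ⊛ b) ⊛ c) k
      ≡⟨ ⊛-def (a ⊛ b) c k ⟩
    sum (λ i → (a ⊛ b) i ℤ.* c (k ⊝ i))
      ≡⟨ sum-cong-≗ (λ i → trans (cong (ℤ._* c (k ⊝ i)) (⊛-def a b i)) (*-distribʳ-sum (c (k ⊝ i)) (λ j → a j ℤ.* b (i ⊝ j)))) ⟩
    sum (λ i → sum (λ j → a j ℤ.* b (i ⊝ j) ℤ.* c (k ⊝ i)))
      ≡⟨ ∑-comm (λ i j → a j ℤ.* b (i ⊝ j) ℤ.* c (k ⊝ i)) ⟩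
    sum (λ j → sum (λ i → a j ℤ.* b (i ⊝ j) ℤ.* c (k ⊝ i)))
      ≡⟨ sum-cong-≗ (λ j → sum-⊕ (λ i → a j ℤ.* b (i ⊝ j) ℤ.* c (k ⊝ i)) j) ⟨
    sum (λ j → sum (λ i → a j ℤ.* b (i ⊕ j ⊝ j) ℤ.* c (k ⊝ (i ⊕ j))))
      ≡⟨ sum-cong-≗ (λ j → sum-cong-≗ (λ i → trans (ℤ.*-assoc (a j) _ _)
           (cong₂ (λ s t → a j ℤ.* (b s ℤ.* c t)) (//-rightDividesʳ j i) (⊝-⊕ k i j)))) ⟩
    sum (λ j → sum (λ i → a j ℤ.* (b i ℤ.* c (k ⊝ j ⊝ i))))
      ≡⟨ sum-cong-≗ (λ j → trans (sym (*-distribˡ-sum (a j) (λ i → b i ℤ.* c (k ⊝ j ⊝ i)))) (cong (a j ℤ.*_) (sym (⊛-def b c (k ⊝ j))))) ⟩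
    sum (λ j → a j ℤ.* (b ⊛ c) (k ⊝ j))
      ≡⟨ ⊛-def a (b ⊛ c) k ⟨
    (a ⊛ (b ⊛ c)) k ∎

  ⊛-distribʳ : ∀ a b c k → ((_+G_ N b c) ⊛ a) k ≡ (_+G_ N (b ⊛ a) (c ⊛ a)) k
  ⊛-distribʳ a b c k = begin
    ((_+G_ N b c) ⊛ a) k                                  ≡⟨ ⊛-def (_+G_ N b c) a k ⟩
    sum (λ i → (b i ℤ.+ c i) ℤ.* a (k ⊝ i))               ≡⟨ sum-cong-≗ (λ i → ℤ.*-distribʳ-+ (a (k ⊝ i)) (b i) (c i)) ⟩
    sum (λ i → b i ℤ.* a (k ⊝ i) ℤ.+ c i ℤ.* a (k ⊝ i))   ≡⟨ ∑-distrib-+ (λ i → b i ℤ.* a (k ⊝ i)) _ ⟩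
    sum (λ i → b i ℤ.* a (k ⊝ i)) ℤ.+ sum (λ i → c i ℤ.* a (k ⊝ i)) ≡⟨ cong₂ ℤ._+_ (⊛-def b a k) (⊛-def c a k) ⟨
    (b ⊛ a) k ℤ.+ (c ⊛ a) k                               ∎

  embed-⊛ : ∀ m a k → (embed N m ⊛ a) k ≡ m ℤ.* a k
  embed-⊛ m a k = begin
    (embed N m ⊛ a) k                                                       ≡⟨ ⊛-def (embed N m) a k ⟩
    sum (λ i → (if does (i ≟ 0#) then m else 0ℤ) ℤ.* a (k ⊝ i))             ≡⟨ sum-cong-≗ (λ i → if-* (does (i ≟ 0#)) m (a (k ⊝ i))) ⟩
    sum (λ i → if does (i ≟ 0#) then m ℤ.* a (k ⊝ i) else 0ℤ)               ≡⟨ sum-cong-≗ (λ i → cong (λ c → if c then m ℤ.* a (k ⊝ i) else 0ℤ) (does-≟-sym i 0#)) ⟩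
    sum (λ i → if does (0# ≟ i) then m ℤ.* a (k ⊝ i) else 0ℤ)               ≡⟨ sum-single 0# (λ i → m ℤ.* a (k ⊝ i)) ⟩
    m ℤ.* a (k ⊝ 0#)                                                        ≡⟨ cong (λ t → m ℤ.* a t) (trans (cong (k ⊕_) ε⁻¹≈ε) (⊕-identityʳ k)) ⟩
    m ℤ.* a k                                                               ∎

  pointwise : ∀ {a b} → (∀ k → a k ≡ b k) → a ≈ b
  pointwise {a} {b} a≗b .un≈ i j = trans (ℤ.i≡j⇒i-j≡0 (a≗b i)) (sym (ℤ.i≡j⇒i-j≡0 (a≗b j)))

  ≈-shift : ∀ {a b} → a ≈ b → ∀ k → a k ≡ b k ℤ.+ (a 0# ℤ.- b 0#)
  ≈-shift {a} {b} a≈b k = begin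
    a k                       ≡⟨ solve 2 (λ x y → x := y :+ (x :- y)) refl (a k) (b k) ⟩
    b k ℤ.+ (a k ℤ.- b k)     ≡⟨ cong (λ t → b k ℤ.+ t) (un≈ a≈b k 0#) ⟩
    b k ℤ.+ (a 0# ℤ.- b 0#)   ∎
    where open +-*-Solver

  shift-≈ : ∀ {a b} c → (∀ k → a k ≡ b k ℤ.+ c) → a ≈ b
  shift-≈ {a} {b} c eq .un≈ i j = trans (diff i) (sym (diff j))
    where
    open +-*-Solver
    diff : ∀ k → a k ℤ.- b k ≡ c
    diff k = trans (cong (ℤ._- b k) (eq k)) (solve 2 (λ y c → y :+ c :- y := c) refl (b k) c)

  -- Constant vectors form an ideal: the constant c times b is the constant c · `sum b`.
  ⊛-congʳ : ∀ {a a′} b → a ≈ a′ → a ⊛ b ≈ a′ ⊛ b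
  ⊛-congʳ {a} {a′} b a≈a′ = shift-≈ (c ℤ.* sum b) (λ k → begin
    (a ⊛ b) k                                                ≡⟨ ⊛-def a b k ⟩
    sum (λ i → a i ℤ.* b (k ⊝ i))                            ≡⟨ sum-cong-≗ (λ i → trans (cong (ℤ._* b (k ⊝ i)) (≈-shift a≈a′ i)) (ℤ.*-distribʳ-+ (b (k ⊝ i)) (a′ i) c)) ⟩
    sum (λ i → a′ i ℤ.* b (k ⊝ i) ℤ.+ c ℤ.* b (k ⊝ i))       ≡⟨ ∑-distrib-+ (λ i → a′ i ℤ.* b (k ⊝ i)) _ ⟩
    sum (λ i → a′ i ℤ.* b (k ⊝ i)) ℤ.+ sum (λ i → c ℤ.* b (k ⊝ i)) ≡⟨ cong₂ ℤ._+_ (⊛-def a′ b k) (*-distribˡ-sum c (λ i → b (k ⊝ i))) ⟨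
    (a′ ⊛ b) k ℤ.+ c ℤ.* sum (λ i → b (k ⊝ i))               ≡⟨ cong (λ t → (a′ ⊛ b) k ℤ.+ c ℤ.* t) (sum-⊝ b k) ⟩
    (a′ ⊛ b) k ℤ.+ c ℤ.* sum b                               ∎)
    where c = a 0# ℤ.- a′ 0#

  ≈-trans : ∀ {a b c} → a ≈ b → b ≈ c → a ≈ c
  ≈-trans {a} {b} {c} p q .un≈ i j = trans (split i) (trans (cong₂ ℤ._+_ (un≈ p i j) (un≈ q i j)) (sym (split j)))
    where
    open +-*-Solver
    split : ∀ k → a k ℤ.- c k ≡ (a k ℤ.- b k) ℤ.+ (b k ℤ.- c k)
    split k = solve 3 (λ x y z → x :- z := (x :- y) :+ (y :- z)) refl (a k) (b k) (c k)

  ≈-sym : ∀ {a b} → a ≈ b → b ≈ a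
  ≈-sym {a} {b} p .un≈ i j = trans (flip i) (trans (cong ℤ.-_ (un≈ p i j)) (sym (flip j)))
    where
    open +-*-Solver
    flip : ∀ k → b k ℤ.- a k ≡ ℤ.- (a k ℤ.- b k)
    flip k = solve 2 (λ x y → y :- x := :- (x :- y)) refl (a k) (b k)

  +-cong : ∀ {a a′ b b′} → a ≈ a′ → b ≈ b′ → _+G_ N a b ≈ _+G_ N a′ b′
  +-cong {a} {a′} {b} {b′} p q .un≈ i j = trans (split i) (trans (cong₂ ℤ._+_ (un≈ p i j) (un≈ q i j)) (sym (split j)))
    where
    open +-*-Solver
    split : ∀ k → (a k ℤ.+ b k) ℤ.- (a′ k ℤ.+ b′ k) ≡ (a k ℤ.- a′ k) ℤ.+ (b k ℤ.- b′ k)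
    split k = solve 4 (λ x y x′ y′ → (x :+ y) :- (x′ :+ y′) := (x :- x′) :+ (y :- y′)) refl (a k) (b k) (a′ k) (b′ k)

  neg-cong : ∀ {a b} → a ≈ b → neg a ≈ neg b
  neg-cong {a} {b} p .un≈ i j = trans (split i) (trans (cong ℤ.-_ (un≈ p i j)) (sym (split j)))
    where
    open +-*-Solver
    split : ∀ k → ℤ.- a k ℤ.- (ℤ.- b k) ≡ ℤ.- (a k ℤ.- b k)
    split k = solve 2 (λ x y → :- x :- (:- y) := :- (x :- y)) refl (a k) (b k)

  ⊛-cong : ∀ {a a′ b b′} → a ≈ a′ → b ≈ b′ → a ⊛ b ≈ a′ ⊛ b′
  ⊛-cong {a} {a′} {b} {b′} p q = ≈-trans (⊛-congʳ b p)
    (≈-trans (pointwise (⊛-comm a′ b)) (≈-trans (⊛-congʳ a′ q) (pointwise (⊛-comm b′ a′))))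

  one-⊛ : ∀ a k → (oneG N ⊛ a) k ≡ a k
  one-⊛ a k = trans (embed-⊛ 1ℤ a k) (ℤ.*-identityˡ (a k))

  ringOfIntegers : CommutativeRing 0ℓ 0ℓ
  ringOfIntegers = record
    { Carrier = GR N ; _≈_ = _≈_ ; _+_ = _+G_ N ; _*_ = _⊛_ ; -_ = neg ; 0# = zeroG N ; 1# = oneG N
    ; isCommutativeRing = record
      { isRing = record
        { +-isAbelianGroup = record
          { isGroup = record
            { isMonoid = record
              { isSemigroup = record
                { isMagma = record
                  { isEquivalence = record
                    { refl = pointwise (λ _ → refl)
                    ; sym = ≈-sym
                    ; trans = ≈-trans }
                  ; ∙-cong = +-cong }
                ; assoc = λ a b c → pointwise (λ k → ℤ.+-assoc (a k) (b k) (c k)) }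
              ; identity = (λ a → pointwise (λ k → ℤ.+-identityˡ (a k))) , (λ a → pointwise (λ k → ℤ.+-identityʳ (a k))) }
            ; inverse = (λ a → pointwise (λ k → ℤ.+-inverseˡ (a k))) , (λ a → pointwise (λ k → ℤ.+-inverseʳ (a k)))
            ; ⁻¹-cong = neg-cong }
          ; comm = λ a b → pointwise (λ k → ℤ.+-comm (a k) (b k)) }
        ; *-cong = ⊛-cong
        ; *-assoc = λ a b c → pointwise (⊛-assoc a b c)
        ; *-identity = (λ a → pointwise (one-⊛ a)) , (λ a → pointwise (λ k → trans (⊛-comm a (oneG N) k) (one-⊛ a k)))
        ; distrib = (λ a b c → pointwise (λ k → trans (⊛-comm a (_+G_ N b c) k)
                        (trans (⊛-distribʳ a b c k) (cong₂ ℤ._+_ (⊛-comm b a k) (⊛-comm c a k)))))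
                  , (λ a b c → pointwise (⊛-distribʳ a b c)) }
      ; *-comm = λ a b → pointwise (⊛-comm a b) } }

  -- Conjugation and the trace form

  conj-⊛ : ∀ a b k → conj N (a ⊛ b) k ≡ (conj N a ⊛ conj N b) k
  conj-⊛ a b k = begin
    (a ⊛ b) (⊖ k)                                  ≡⟨ ⊛-def a b (⊖ k) ⟩
    sum (λ i → a i ℤ.* b ((⊖ k) ⊝ i))              ≡⟨ sum-⊖ (λ i → a i ℤ.* b ((⊖ k) ⊝ i)) ⟨
    sum (λ i → a (⊖ i) ℤ.* b ((⊖ k) ⊝ (⊖ i)))      ≡⟨ sum-cong-≗ (λ i → cong (λ t → a (⊖ i) ℤ.* b t) (⁻¹-∙-comm k (⊖ i))) ⟩
    sum (λ i → a (⊖ i) ℤ.* b (⊖ (k ⊝ i)))          ≡⟨ ⊛-def (conj N a) (conj N b) k ⟨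
    (conj N a ⊛ conj N b) k                        ∎

  embed-0# : ∀ m → embed N m 0# ≡ m
  embed-0# m = cong (λ c → if c then m else 0ℤ) (dec-true (0# ≟ 0#) refl)

  embed-≢ : ∀ m k → k ≢ 0# → embed N m k ≡ 0ℤ
  embed-≢ m k k≢0 = cong (λ c → if c then m else 0ℤ) (dec-false (k ≟ 0#) k≢0)

  conj-embed : ∀ m k → conj N (embed N m) k ≡ embed N m k
  conj-embed m k with k ≟ 0#
  ... | yes refl = trans (cong (embed N m) ε⁻¹≈ε) (embed-0# m)
  ... | no k≢0 = embed-≢ m (⊖ k) (λ ⊖k≡0 → k≢0 (trans (sym (⁻¹-involutive k)) (trans (cong ⊖_ ⊖k≡0) ε⁻¹≈ε)))

  -- For prime N this is the field trace, with Tr 1 = N - 1 and Tr ζ^k = -1 for k not divisible by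
  -- N. Constant vectors have trace 0, so it descends to the quotient.
  trace : GR N → ℤ
  trace a = + N ℤ.* a 0# ℤ.- sum a

  trace-cong : ∀ {a b} → a ≈ b → trace a ≡ trace b
  trace-cong {a} {b} a≈b = begin
    + N ℤ.* a 0# ℤ.- sum a
      ≡⟨ cong₂ (λ x y → + N ℤ.* x ℤ.- y) (≈-shift a≈b 0#)
           (trans (sum-cong-≗ (≈-shift a≈b)) (trans (∑-distrib-+ b (λ _ → c)) (cong (λ t → sum b ℤ.+ t) (sum-const N c)))) ⟩
    + N ℤ.* (b 0# ℤ.+ c) ℤ.- (sum b ℤ.+ + N ℤ.* c)
      ≡⟨ solve 4 (λ n x s c → n :* (x :+ c) :- (s :+ n :* c) := n :* x :- s) refl (+ N) (b 0#) (sum b) c ⟩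
    + N ℤ.* b 0# ℤ.- sum b ∎
    where
    open +-*-Solver
    c = a 0# ℤ.- b 0#

  trace-+ : ∀ a b → trace (_+G_ N a b) ≡ trace a ℤ.+ trace b
  trace-+ a b = trans (cong (λ s → + N ℤ.* (a 0# ℤ.+ b 0#) ℤ.- s) (∑-distrib-+ a b))
    (solve 5 (λ n x y s t → n :* (x :+ y) :- (s :+ t) := (n :* x :- s) :+ (n :* y :- t)) refl (+ N) (a 0#) (b 0#) (sum a) (sum b))
    where open +-*-Solver

  norm-def : ∀ a k → (a ⊛ conj N a) k ≡ sum (λ i → a i ℤ.* a (i ⊝ k))
  norm-def a k = trans (⊛-def a (conj N a) k) (sum-cong-≗ (λ i → cong (λ t → a i ℤ.* a t) (⊖-⊝ k i)))

  energy : GR N → ℤ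
  energy a = sum (λ i → a i ℤ.* a i)

  trace-norm : ∀ a → trace (a ⊛ conj N a) ≡ + N ℤ.* energy a ℤ.- sum a ℤ.* sum a
  trace-norm a = cong₂ (λ x s → + N ℤ.* x ℤ.- s)
    (trans (norm-def a 0#) (sum-cong-≗ (λ i → cong (λ t → a i ℤ.* a t) (trans (cong (i ⊕_) ε⁻¹≈ε) (⊕-identityʳ i)))))
    (begin
      sum (a ⊛ conj N a)                              ≡⟨ sum-cong-≗ (norm-def a) ⟩
      sum (λ k → sum (λ i → a i ℤ.* a (i ⊝ k)))       ≡⟨ ∑-comm (λ k i → a i ℤ.* a (i ⊝ k)) ⟩
      sum (λ i → sum (λ k → a i ℤ.* a (i ⊝ k)))       ≡⟨ sum-cong-≗ (λ i → trans (sym (*-distribˡ-sum (a i) (λ k → a (i ⊝ k)))) (cong (a i ℤ.*_) (sum-⊝ a i))) ⟩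
      sum (λ i → a i ℤ.* sum a)                       ≡⟨ *-distribʳ-sum (sum a) a ⟨
      sum a ℤ.* sum a                                 ∎)

  centred : GR N → GR N
  centred a k = + N ℤ.* a k ℤ.- sum a

  -- The variance identity: it makes N times the trace a sum of squares. That sum vanishes only if
  -- every N a_i equals `sum a`, so only for constant vectors, which are zero in the quotient.
  energy-centred : ∀ a → energy (centred a) ≡ + N ℤ.* trace (a ⊛ conj N a)
  energy-centred a = begin
    sum (λ i → centred a i ℤ.* centred a i)
      ≡⟨ sum-cong-≗ (λ i → solve 3 (λ n x s → (n :* x :- s) :* (n :* x :- s) := n :* n :* (x :* x) :+ ((:- (n :* s :+ n :* s)) :* x :+ s :* s)) refl n (a i) s) ⟩
    sum (λ i → n ℤ.* n ℤ.* (a i ℤ.* a i) ℤ.+ (c ℤ.* a i ℤ.+ s ℤ.* s))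
      ≡⟨ trans (∑-distrib-+ (λ i → n ℤ.* n ℤ.* (a i ℤ.* a i)) _) (cong (λ t → sum (λ i → n ℤ.* n ℤ.* (a i ℤ.* a i)) ℤ.+ t) (∑-distrib-+ (λ i → c ℤ.* a i) _)) ⟩
    sum (λ i → n ℤ.* n ℤ.* (a i ℤ.* a i)) ℤ.+ (sum (λ i → c ℤ.* a i) ℤ.+ sum {N} (λ _ → s ℤ.* s))
      ≡⟨ cong₂ ℤ._+_ (sym (*-distribˡ-sum (n ℤ.* n) (λ i → a i ℤ.* a i))) (cong₂ ℤ._+_ (sym (*-distribˡ-sum c a)) (sum-const N (s ℤ.* s))) ⟩
    n ℤ.* n ℤ.* energy a ℤ.+ (c ℤ.* s ℤ.+ n ℤ.* (s ℤ.* s))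
      ≡⟨ solve 3 (λ n e s → n :* n :* e :+ ((:- (n :* s :+ n :* s)) :* s :+ n :* (s :* s)) := n :* (n :* e :- s :* s)) refl n (energy a) s ⟩
    n ℤ.* (n ℤ.* energy a ℤ.- s ℤ.* s)
      ≡⟨ cong (n ℤ.*_) (trace-norm a) ⟨
    n ℤ.* trace (a ⊛ conj N a) ∎
    where
    open +-*-Solver
    n = + N
    s = sum a
    c = ℤ.- (n ℤ.* s ℤ.+ n ℤ.* s)

  +N-positive : ℤ.Positive (+ N)
  +N-positive = ℤ.positive (ℤ.+<+ (ℕ.>-nonZero⁻¹ N))

  trace-norm-nonneg : ∀ a → 0ℤ ℤ.≤ trace (a ⊛ conj N a)
  trace-norm-nonneg a = ℤ.*-cancelˡ-≤-pos _ _ (+ N) {{+N-positive}} (ℤ.≤-trans (ℤ.≤-reflexive (ℤ.*-zeroʳ (+ N)))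
    (ℤ.≤-trans (sum-nonneg _ (λ i → square-nonneg (centred a i))) (ℤ.≤-reflexive (energy-centred a))))

  trace-norm-definite : ∀ a → trace (a ⊛ conj N a) ℤ.≤ 0ℤ → a ≈ zeroG N
  trace-norm-definite a t≤0 .un≈ i j = cong (ℤ._- 0ℤ) (ℤ.*-cancelˡ-≡ (+ N) (a i) (a j) (trans (centred≡0 i) (sym (centred≡0 j))))
    where
    energy≤0 : energy (centred a) ℤ.≤ 0ℤ
    energy≤0 = ℤ.≤-trans (ℤ.≤-reflexive (energy-centred a)) (ℤ.≤-trans
      (ℤ.*-monoˡ-≤-nonNeg (+ N) t≤0) (ℤ.≤-reflexive (ℤ.*-zeroʳ (+ N))))
    square≡0 : ∀ i → centred a i ℤ.* centred a i ≡ 0ℤ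
    square≡0 i = ℤ.≤-antisym
      (ℤ.≤-trans (term≤sum _ (λ i → square-nonneg (centred a i)) i) energy≤0) (square-nonneg (centred a i))
    centred≡0 : ∀ i → + N ℤ.* a i ≡ sum a
    centred≡0 i = ℤ.i-j≡0⇒i≡j _ _ ([ id , id ]′ (ℤ.i*j≡0⇒i≡0∨j≡0 (centred a i) (square≡0 i)))

  trace-one : trace (oneG N) ≡ + N ℤ.- 1ℤ
  trace-one = cong₂ ℤ._-_ (trans (cong (λ t → + N ℤ.* t) (embed-0# 1ℤ)) (ℤ.*-identityʳ (+ N)))
    (trans (sum-cong-≗ (λ k → cong (λ c → if c then 1ℤ else 0ℤ) (does-≟-sym k 0#))) (sum-single 0# (λ _ → 1ℤ)))

  starRing : 1 ℕ.< N → PositiveStarRing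
  starRing 1<N = record
    { commutativeRing = ringOfIntegers
    ; conj = conj N
    ; conj-cong = λ a≈b → mk≈ (λ i j → un≈ a≈b (⊖ i) (⊖ j))
    ; conj-+ = λ a b → pointwise (λ _ → refl)
    ; conj-* = λ a b → pointwise (conj-⊛ a b)
    ; conj-neg = λ a → pointwise (λ _ → refl)
    ; conj-1 = pointwise (conj-embed 1ℤ)
    ; conj-involutive = λ a → pointwise (λ k → cong a (⁻¹-involutive k))
    ; tr = trace
    ; tr-cong = trace-cong
    ; tr-+ = trace-+
    ; tr-1-positive = ℤ.positive (subst (0ℤ ℤ.<_) (sym trace-one) (ℤ.+-monoˡ-< ℤ.-1ℤ (ℤ.+<+ 1<N)))
    ; tr-norm-nonneg = trace-norm-nonneg
    ; tr-definite = trace-norm-definite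
    }

  -- The maps σ_j and the sum of the conjugate norms

  _⊙_ : Fin N → ℕ → Fin N
  i ⊙ j = ix N (toℕ i ℕ.* j)

  ix-⊙ : ∀ m j → ix N m ⊙ j ≡ ix N (m ℕ.* j)
  ix-⊙ m j = trans (cong (λ t → ix N (t ℕ.* j)) (toℕ-ix m)) (ix-cong _ _ (begin
    (m % N ℕ.* j) % N                 ≡⟨ %-distribˡ-* (m % N) j N ⟩
    (m % N % N ℕ.* (j % N)) % N       ≡⟨ cong (λ t → (t ℕ.* (j % N)) % N) (m%n%n≡m%n m N) ⟩
    (m % N ℕ.* (j % N)) % N           ≡⟨ %-distribˡ-* m j N ⟨
    (m ℕ.* j) % N                     ∎))

  ⊙-distribʳ : ∀ i i′ j → (i ⊕ i′) ⊙ j ≡ i ⊙ j ⊕ i′ ⊙ j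
  ⊙-distribʳ i i′ j = trans (ix-⊙ _ j) (trans (cong (ix N) (ℕ.*-distribʳ-+ j (toℕ i) (toℕ i′))) (sym (ix-+ _ _)))

  0⊙ : ∀ j → 0# ⊙ j ≡ 0#
  0⊙ j = ix-⊙ 0 j

  ⊝-⊙ : ∀ i i′ j → (i ⊝ i′) ⊙ j ≡ i ⊙ j ⊝ i′ ⊙ j
  ⊝-⊙ i i′ j = trans (⊙-distribʳ i (⊖ i′) j) (cong (i ⊙ j ⊕_) (inverseˡ-unique ((⊖ i′) ⊙ j) (i′ ⊙ j)
    (trans (sym (⊙-distribʳ (⊖ i′) i′ j)) (trans (cong (_⊙ j) (⊖-inverseˡ i′)) (0⊙ j)))))

  ∣⇒≡0 : ∀ i → N ∣ toℕ i → i ≡ 0#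
  ∣⇒≡0 i N∣i = trans (sym (ix-toℕ i)) (ix-cong _ 0 (trans (n∣m⇒m%n≡0 _ N N∣i) (sym (m<n⇒m%n≡m (ℕ.>-nonZero⁻¹ N)))))

  -- Euclid's lemma: N divides (j - j′) d but not d. Multiplication by d thus permutes the residues,
  -- which is what `count` uses.
  ⊙-injective : Prime N → ∀ {d} → d ≢ 0# → Injective _≡_ _≡_ (λ j → d ⊙ toℕ j)
  ⊙-injective N-prime {d} d≢0 {j} {j′} eq = x∙y⁻¹≈ε⇒x≈y j j′ ([ ∣⇒≡0 (j ⊝ j′) , (λ N∣d → contradiction (∣⇒≡0 d N∣d) d≢0) ]′
    (euclidsLemma (toℕ (j ⊝ j′)) (toℕ d) N-prime (m%n≡0⇒n∣m _ N (trans (sym (toℕ-ix _))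
      (trans (cong toℕ product≡0) (trans (toℕ-ix 0) (m<n⇒m%n≡m (ℕ.>-nonZero⁻¹ N))))))))
    where
    swap : ∀ i → d ⊙ toℕ i ≡ i ⊙ toℕ d
    swap i = cong (ix N) (ℕ.*-comm (toℕ d) (toℕ i))
    product≡0 : (j ⊝ j′) ⊙ toℕ d ≡ 0#
    product≡0 = trans (⊝-⊙ j j′ (toℕ d)) (trans (cong (_⊝ j′ ⊙ toℕ d) (trans (sym (swap j)) (trans eq (swap j′)))) (⊖-inverseʳ _))

  σ-def : ∀ j a k → σ N j a k ≡ sum (λ i → if does (k ≟ i ⊙ j) then a i else 0ℤ)
  σ-def j a k = sumFin≡sum {N} _

  -- σ_j pushes coefficients forward along i ↦ ij, so pairing with g pulls g back. This covers j = 0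
  -- too, where all indices collapse to 0.
  σ-pairing : ∀ j (a : GR N) (g : Fin N → ℤ) → sum (λ l → σ N j a l ℤ.* g l) ≡ sum (λ i → a i ℤ.* g (i ⊙ j))
  σ-pairing j a g = begin
    sum (λ l → σ N j a l ℤ.* g l)
      ≡⟨ sum-cong-≗ (λ l → trans (cong (ℤ._* g l) (σ-def j a l)) (*-distribʳ-sum (g l) (λ i → if does (l ≟ i ⊙ j) then a i else 0ℤ))) ⟩
    sum (λ l → sum (λ i → (if does (l ≟ i ⊙ j) then a i else 0ℤ) ℤ.* g l))
      ≡⟨ ∑-comm (λ l i → (if does (l ≟ i ⊙ j) then a i else 0ℤ) ℤ.* g l) ⟩
    sum (λ i → sum (λ l → (if does (l ≟ i ⊙ j) then a i else 0ℤ) ℤ.* g l))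
      ≡⟨ sum-cong-≗ (λ i → trans (sum-cong-≗ (λ l → trans (if-* (does (l ≟ i ⊙ j)) (a i) (g l))
           (cong (λ c → if c then a i ℤ.* g l else 0ℤ) (does-≟-sym l (i ⊙ j))))) (sum-single (i ⊙ j) (λ l → a i ℤ.* g l))) ⟩
    sum (λ i → a i ℤ.* g (i ⊙ j)) ∎

  conjugateNorm : ℕ → GR N → GR N
  conjugateNorm j a = σ N j a ⊛ conj N (σ N j a)

  -- In this form j occurs only in the condition k = (i - i′) j, so the sum over j can be taken
  -- separately for each pair (i, i′).
  conjugateNorm-def : ∀ j a k → conjugateNorm j a k
    ≡ sum (λ i → a i ℤ.* sum (λ i′ → if does (k ≟ (i ⊝ i′) ⊙ j) then a i′ else 0ℤ))
  conjugateNorm-def j a k = trans (norm-def (σ N j a) k) (trans (σ-pairing j a (λ l → σ N j a (l ⊝ k)))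
    (sum-cong-≗ (λ i → cong (a i ℤ.*_) (trans (σ-def j a (i ⊙ j ⊝ k)) (sum-cong-≗ (λ i′ → cong (λ c → if c then a i′ else 0ℤ)
      (does-⇔ (mk⇔ (to i i′) (from i i′)) (i ⊙ j ⊝ k ≟ i′ ⊙ j) (k ≟ (i ⊝ i′) ⊙ j))))))))
    where
    to : ∀ i i′ → i ⊙ j ⊝ k ≡ i′ ⊙ j → k ≡ (i ⊝ i′) ⊙ j
    to i i′ eq = trans (sym (⊝-⊝ (i ⊙ j) k)) (trans (cong (i ⊙ j ⊝_) eq) (sym (⊝-⊙ i i′ j)))
    from : ∀ i i′ → k ≡ (i ⊝ i′) ⊙ j → i ⊙ j ⊝ k ≡ i′ ⊙ j
    from i i′ eq = trans (cong (i ⊙ j ⊝_) (trans eq (⊝-⊙ i i′ j))) (⊝-⊝ (i ⊙ j) (i′ ⊙ j))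

  -- σ_0 is the augmentation, not an automorphism. It is included so that j runs over all residues,
  -- and its contribution is subtracted later.
  conjugateNorm-0 : ∀ a k → conjugateNorm 0 a k ≡ embed N (sum a ℤ.* sum a) k
  conjugateNorm-0 a k = begin
    conjugateNorm 0 a k
      ≡⟨ conjugateNorm-def 0 a k ⟩
    sum (λ i → a i ℤ.* sum (λ i′ → if does (k ≟ (i ⊝ i′) ⊙ 0) then a i′ else 0ℤ))
      ≡⟨ sum-cong-≗ (λ i → cong (a i ℤ.*_) (trans (sum-cong-≗ (λ i′ → cong (λ t → if does (k ≟ ix N t) then a i′ else 0ℤ) (ℕ.*-zeroʳ (toℕ (i ⊝ i′))))) (sum-if (does (k ≟ 0#)) a))) ⟩
    sum (λ i → a i ℤ.* (if does (k ≟ 0#) then sum a else 0ℤ))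
      ≡⟨ *-distribʳ-sum (if does (k ≟ 0#) then sum a else 0ℤ) a ⟨
    sum a ℤ.* (if does (k ≟ 0#) then sum a else 0ℤ)
      ≡⟨ trans (ℤ.*-comm (sum a) _) (if-* (does (k ≟ 0#)) (sum a) (sum a)) ⟩
    embed N (sum a ℤ.* sum a) k ∎

  -- For i ≠ i′ exactly one j satisfies (i - i′) j = k; for i = i′ it is all j or none.
  count : Prime N → ∀ k i i′ c → sum {N} (λ j → if does (k ≟ (i ⊝ i′) ⊙ toℕ j) then c else 0ℤ)
    ≡ c ℤ.+ (if does (i ≟ i′) then embed N (+ N) k ℤ.* c ℤ.- c else 0ℤ)
  count N-prime k i i′ c with i ≟ i′
  ... | yes refl = begin
    sum {N} (λ j → if does (k ≟ (i ⊝ i) ⊙ toℕ j) then c else 0ℤ)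
      ≡⟨ sum-cong-≗ {N} (λ j → cong (λ t → if does (k ≟ t) then c else 0ℤ) (trans (cong (_⊙ toℕ j) (⊖-inverseʳ i)) (0⊙ (toℕ j)))) ⟩
    sum {N} (λ _ → if does (k ≟ 0#) then c else 0ℤ)
      ≡⟨ sum-const N _ ⟩
    + N ℤ.* (if does (k ≟ 0#) then c else 0ℤ)
      ≡⟨ trans (ℤ.*-comm (+ N) _) (trans (if-* (does (k ≟ 0#)) c (+ N)) (trans (cong (λ t → if does (k ≟ 0#) then t else 0ℤ) (ℤ.*-comm c (+ N)))
           (sym (if-* (does (k ≟ 0#)) (+ N) c)))) ⟩
    embed N (+ N) k ℤ.* c
      ≡⟨ solve 2 (λ e c → e := c :+ (e :- c)) refl (embed N (+ N) k ℤ.* c) c ⟩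
    c ℤ.+ (embed N (+ N) k ℤ.* c ℤ.- c) ∎
    where open +-*-Solver
  ... | no i≢i′ = begin
    sum {N} (λ j → if does (k ≟ (i ⊝ i′) ⊙ toℕ j) then c else 0ℤ)
      ≡⟨ sum-permute (λ j → if does (k ≟ j) then c else 0ℤ)
           (injective⇒permutation (⊙-injective N-prime (λ d≡0 → i≢i′ (x∙y⁻¹≈ε⇒x≈y i i′ d≡0)))) ⟨
    sum (λ j → if does (k ≟ j) then c else 0ℤ)
      ≡⟨ sum-single k (λ _ → c) ⟩
    c
      ≡⟨ ℤ.+-identityʳ c ⟨
    c ℤ.+ 0ℤ ∎

  -- Pairs i = i′ contribute N · `energy a`, at k = 0 only. Every pair i ≠ i′ contributes a_i a_i′
  -- at each k; together these form the constant vector (sum a)² - `energy a`, which is zero in the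
  -- quotient.
  conjugateNorm-sum : Prime N → ∀ a k → sum {N} (λ j → conjugateNorm (toℕ j) a k)
    ≡ embed N (+ N) k ℤ.* energy a ℤ.+ (sum a ℤ.* sum a ℤ.- energy a)
  conjugateNorm-sum N-prime a k = begin
    sum {N} (λ j → conjugateNorm (toℕ j) a k)
      ≡⟨ sum-cong-≗ {N} (λ j → conjugateNorm-def (toℕ j) a k) ⟩
    sum {N} (λ j → sum (λ i → a i ℤ.* sum (λ i′ → δ i i′ j)))
      ≡⟨ ∑-comm (λ j i → a i ℤ.* sum (λ i′ → δ i i′ j)) ⟩
    sum (λ i → sum (λ j → a i ℤ.* sum (λ i′ → δ i i′ j)))
      ≡⟨ sum-cong-≗ (λ i → trans (sym (*-distribˡ-sum (a i) (λ j → sum (λ i′ → δ i i′ j)))) (cong (a i ℤ.*_) (∑-comm (λ j i′ → δ i i′ j)))) ⟩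
    sum (λ i → a i ℤ.* sum (λ i′ → sum (δ i i′)))
      ≡⟨ sum-cong-≗ (λ i → cong (a i ℤ.*_) (trans (sum-cong-≗ (λ i′ → count N-prime k i i′ (a i′)))
           (trans (∑-distrib-+ a _) (cong (λ t → s ℤ.+ t) (sum-single i (λ i′ → e ℤ.* a i′ ℤ.- a i′)))))) ⟩
    sum (λ i → a i ℤ.* (s ℤ.+ (e ℤ.* a i ℤ.- a i)))
      ≡⟨ sum-cong-≗ (λ i → solve 3 (λ x s e → x :* (s :+ (e :* x :- x)) := (e :- con 1ℤ) :* (x :* x) :+ s :* x) refl (a i) s e) ⟩
    sum (λ i → (e ℤ.- 1ℤ) ℤ.* (a i ℤ.* a i) ℤ.+ s ℤ.* a i)
      ≡⟨ trans (∑-distrib-+ (λ i → (e ℤ.- 1ℤ) ℤ.* (a i ℤ.* a i)) _)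
           (sym (cong₂ ℤ._+_ (*-distribˡ-sum (e ℤ.- 1ℤ) (λ i → a i ℤ.* a i)) (*-distribˡ-sum s a))) ⟩
    (e ℤ.- 1ℤ) ℤ.* energy a ℤ.+ s ℤ.* s
      ≡⟨ solve 3 (λ e q s → (e :- con 1ℤ) :* q :+ s :* s := e :* q :+ (s :* s :- q)) refl e (energy a) s ⟩
    e ℤ.* energy a ℤ.+ (s ℤ.* s ℤ.- energy a) ∎
    where
    open +-*-Solver
    s = sum a
    e = embed N (+ N) k
    δ : Fin N → Fin N → Fin N → ℤ
    δ i i′ j = if does (k ≟ (i ⊝ i′) ⊙ toℕ j) then a i′ else 0ℤ

  σ-1 : ∀ a k → σ N 1 a k ≡ a k
  σ-1 a k = trans (σ-def 1 a k) (trans (sum-cong-≗ (λ i → cong (λ t → if does (k ≟ t) then a i else 0ℤ)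
    (trans (cong (ix N) (ℕ.*-identityʳ (toℕ i))) (ix-toℕ i)))) (sum-single k a))

  sum-suc : ∀ (f : ℕ → ℤ) → sum {N} (λ j → f (toℕ j)) ≡ f 0 ℤ.+ sum {N ℕ.∸ 1} (λ j → f (suc (toℕ j)))
  sum-suc f = go N f
    where
    go : ∀ n .{{_ : NonZero n}} (f : ℕ → ℤ) → sum {n} (λ j → f (toℕ j)) ≡ f 0 ℤ.+ sum {n ℕ.∸ 1} (λ j → f (suc (toℕ j)))
    go (suc n) f = refl

  -- The energy is the sum or its negative, according to the sign of the coordinates; squaring
  -- treats both cases alike.
  energy²≡sum² : ∀ b → Binary N b → energy b ℤ.* energy b ≡ sum b ℤ.* sum b
  energy²≡sum² b (_ , inj₁ 0∨1) = cong (λ e → e ℤ.* e) (sum-cong-≗ (λ i → [ (λ eq → idem eq refl) , (λ eq → idem eq refl) ]′ (0∨1 i)))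
    where
    idem : ∀ {x y} → x ≡ y → y ℤ.* y ≡ y → x ℤ.* x ≡ x
    idem refl eq = eq
  energy²≡sum² b (_ , inj₂ -1∨0) = trans (cong (λ e → e ℤ.* e) (trans
      (sum-cong-≗ (λ i → [ (λ eq → neg-idem eq refl) , (λ eq → neg-idem eq refl) ]′ (-1∨0 i))) (sum-neg b)))
    (solve 1 (λ x → :- x :* :- x := x :* x) refl (sum b))
    where
    open +-*-Solver
    neg-idem : ∀ {x y} → x ≡ y → y ℤ.* y ≡ ℤ.- y → x ℤ.* x ≡ ℤ.- x
    neg-idem refl eq = eq

if-zero : ∀ c → (if c then 0ℤ else 0ℤ) ≡ 0ℤ
if-zero true  = refl
if-zero false = refl

if-+ : ∀ c (x y : ℤ) → (if c then x else 0ℤ) ℤ.+ (if c then y else 0ℤ) ≡ (if c then x ℤ.+ y else 0ℤ)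
if-+ true  x y = refl
if-+ false x y = refl

-- The norm bound

module Norms (N : ℕ) .{{N≢0 : NonZero N}} (1<N : 1 ℕ.< N) (b : GR N) where
  open GroupRing N
  private module R = PositiveStarRingProperties (starRing 1<N)
  open R using (ν)
  open R.AMGM (λ j → σ N (suc j) b)

  ν≗embed : ∀ n k → ν n k ≡ embed N (+ n) k
  ν≗embed zero    k = sym (if-zero (does (k ≟ 0#)))
  ν≗embed (suc n) k = trans (cong (λ t → oneG N k ℤ.+ t) (ν≗embed n k)) (if-+ (does (k ≟ 0#)) 1ℤ (+ n))

  -- By `trace-norm` the integer inside is the trace of b b̄, hence nonnegative; the absolute value
  -- only moves it to ℕ.
  normSum : ℕ
  normSum = ℤ.∣ + N ℤ.* energy b ℤ.- sum b ℤ.* sum b ∣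

  normSum-def : + normSum ≡ + N ℤ.* energy b ℤ.- sum b ℤ.* sum b
  normSum-def = ℤ.0≤i⇒+∣i∣≡i (subst (0ℤ ℤ.≤_) (trace-norm b) (trace-norm-nonneg b))

  sumNorms-pointwise : ∀ js k → sumNorms js k ≡ foldr (λ j s → conjugateNorm (suc j) b k ℤ.+ s) 0ℤ js
  sumNorms-pointwise []       k = refl
  sumNorms-pointwise (j ∷ js) k = cong (λ t → conjugateNorm (suc j) b k ℤ.+ t) (sumNorms-pointwise js k)

  sumNorms≈normSum : Prime N → sumNorms (upTo (N ℕ.∸ 1)) ≈ ν normSum
  -- The shift is the constant vector left over by `conjugateNorm-sum`; removing j = 0 takes s² off
  -- the coefficient at 0.
  sumNorms≈normSum N-prime = shift-≈ (s ℤ.* s ℤ.- Q) (λ k → begin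
    sumNorms (upTo (N ℕ.∸ 1)) k
      ≡⟨ trans (sumNorms-pointwise (upTo (N ℕ.∸ 1)) k) (sumRange (N ℕ.∸ 1) (λ j → conjugateNorm (suc j) b k) id) ⟩
    X k
      ≡⟨ solve 2 (λ x y → x := y :+ x :- y) refl (X k) (conjugateNorm 0 b k) ⟩
    conjugateNorm 0 b k ℤ.+ X k ℤ.- conjugateNorm 0 b k
      ≡⟨ cong₂ ℤ._-_ (trans (sym (sum-suc (λ j → conjugateNorm j b k))) (conjugateNorm-sum N-prime b k)) (conjugateNorm-0 b k) ⟩
    embed N (+ N) k ℤ.* Q ℤ.+ (s ℤ.* s ℤ.- Q) ℤ.- embed N (s ℤ.* s) k
      ≡⟨ solve 3 (λ x y z → x :+ y :- z := x :- z :+ y) refl (embed N (+ N) k ℤ.* Q) (s ℤ.* s ℤ.- Q) (embed N (s ℤ.* s) k) ⟩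
    embed N (+ N) k ℤ.* Q ℤ.- embed N (s ℤ.* s) k ℤ.+ (s ℤ.* s ℤ.- Q)
      ≡⟨ cong (λ t → t ℤ.+ (s ℤ.* s ℤ.- Q)) (trans (combine (does (k ≟ 0#))) (trans (cong (λ t → embed N t k) (sym normSum-def)) (sym (ν≗embed normSum k)))) ⟩
    ν normSum k ℤ.+ (s ℤ.* s ℤ.- Q) ∎)
    where
    open +-*-Solver
    s = sum b
    Q = energy b
    X : Fin N → ℤ
    X k = sum {N ℕ.∸ 1} (λ j → conjugateNorm (suc (toℕ j)) b k)
    combine : ∀ c → (if c then + N else 0ℤ) ℤ.* Q ℤ.- (if c then s ℤ.* s else 0ℤ)
                  ≡ (if c then + N ℤ.* Q ℤ.- s ℤ.* s else 0ℤ)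
    combine true  = refl
    combine false = trans (ℤ.+-identityʳ (0ℤ ℤ.* Q)) (ℤ.*-zeroˡ Q)

  productNorms≈square : ∀ m → IsNorm N b m → productNorms (upTo (N ℕ.∸ 1)) ≈ ν (ℤ.∣ m ∣ ℕ.* ℤ.∣ m ∣)
  productNorms≈square m norm≡m = ≈-trans (productNorms≈norm (upTo (N ℕ.∸ 1))) (≈-trans
    -- Here π is `normProd N b` by definition, so the hypothesis applies to it and, conjugated, to
    -- its conjugate.
    (⊛-cong {normProd N b} {embed N m} {conj N (normProd N b)} {embed N m} (mk≈ norm≡m) (≈-trans (mk≈ (λ i j → norm≡m (⊖ i) (⊖ j))) (pointwise (conj-embed m))))
    (pointwise (λ k → begin
      (embed N m ⊛ embed N m) k             ≡⟨ embed-⊛ m (embed N m) k ⟩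
      m ℤ.* embed N m k                     ≡⟨ trans (ℤ.*-comm m _) (if-* (does (k ≟ 0#)) m m) ⟩
      embed N (m ℤ.* m) k                   ≡⟨ cong (λ t → embed N t k) (square≡ m) ⟩
      embed N (+ (ℤ.∣ m ∣ ℕ.* ℤ.∣ m ∣)) k   ≡⟨ ν≗embed (ℤ.∣ m ∣ ℕ.* ℤ.∣ m ∣) k ⟨
      ν (ℤ.∣ m ∣ ℕ.* ℤ.∣ m ∣) k             ∎)))
    where
    square≡ : ∀ m → m ℤ.* m ≡ + (ℤ.∣ m ∣ ℕ.* ℤ.∣ m ∣)
    square≡ (+ n)        = sym (ℤ.pos-* n n)
    square≡ ℤ.-[1+ n ]   = refl

  -- The factor n is cancelled on coefficients: being an integer in the quotient means that all
  -- coefficients away from 0 agree, and in ℤ this survives division by n. Residue 1 represents the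
  -- nonzero residues.
  multiple-integral⇒perfect : ∀ n s .{{_ : NonZero n}} → ν n ⊛ conjugateNorm 1 b ≈ ν s → Perfect N b
  multiple-integral⇒perfect n s eq = γ 0# ℤ.- γ (ix N 1) , un≈ (shift-≈ {γ} (γ (ix N 1)) constant)
    where
    γ = b ⊛ conj N b

    1≢0 : ix N 1 ≢ 0#
    1≢0 1≡0 = contradiction (trans (sym (m<n⇒m%n≡m 1<N)) (trans (sym (toℕ-ix 1)) (trans (cong toℕ 1≡0) (trans (toℕ-ix 0) (m<n⇒m%n≡m (ℕ.m<n⇒0<n 1<N)))))) ℕ.1+n≢0

    scaled : ν n ⊛ γ ≈ ν s
    scaled = ≈-trans (⊛-cong {ν n} {ν n} {γ} {conjugateNorm 1 b} (pointwise (λ _ → refl))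
      (⊛-cong {b} {σ N 1 b} {conj N b} {conj N (σ N 1 b)} (pointwise (λ k → sym (σ-1 b k))) (pointwise (λ k → sym (σ-1 b (⊖ k)))))) eq

    scaled-def : ∀ k → (ν n ⊛ γ) k ≡ + n ℤ.* γ k
    scaled-def k = begin
      (ν n ⊛ γ) k                                  ≡⟨ ⊛-def (ν n) γ k ⟩
      sum (λ i → ν n i ℤ.* γ (k ⊝ i))              ≡⟨ sum-cong-≗ (λ i → cong (λ t → t ℤ.* γ (k ⊝ i)) (ν≗embed n i)) ⟩
      sum (λ i → embed N (+ n) i ℤ.* γ (k ⊝ i))    ≡⟨ ⊛-def (embed N (+ n)) γ k ⟨
      (embed N (+ n) ⊛ γ) k                        ≡⟨ embed-⊛ (+ n) γ k ⟩
      + n ℤ.* γ k                                  ∎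

    off-diagonal : ∀ k → k ≢ 0# → + n ℤ.* γ k ≡ (ν n ⊛ γ) 0# ℤ.- ν s 0#
    off-diagonal k k≢0 = trans (sym (scaled-def k)) (trans (≈-shift scaled k)
      (trans (cong (λ t → t ℤ.+ ((ν n ⊛ γ) 0# ℤ.- ν s 0#)) (trans (ν≗embed s k) (embed-≢ (+ s) k k≢0))) (ℤ.+-identityˡ _)))

    constant : ∀ k → γ k ≡ embed N (γ 0# ℤ.- γ (ix N 1)) k ℤ.+ γ (ix N 1)
    constant k with k ≟ 0#
    ... | yes refl = solve 2 (λ x y → x := x :- y :+ y) refl (γ 0#) (γ (ix N 1))
      where open +-*-Solver
    ... | no k≢0 = trans (ℤ.*-cancelˡ-≡ (+ n) (γ k) (γ (ix N 1)) (trans (off-diagonal k k≢0) (sym (off-diagonal (ix N 1) 1≢0))))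
      (sym (ℤ.+-identityˡ _))

-- The bound (N² - 1)/4 for the sum of the conjugate norms

pronic-nonneg : ∀ u → 0ℤ ℤ.≤ u ℤ.* (u ℤ.+ 1ℤ)
pronic-nonneg (+ n)      = subst (0ℤ ℤ.≤_) (ℤ.pos-* n (n ℕ.+ 1)) (ℤ.+≤+ ℕ.z≤n)
pronic-nonneg ℤ.-[1+ n ] = subst (0ℤ ℤ.≤_) (trans (ℤ.pos-* (suc n) n)
    (solve 1 (λ v → (con 1ℤ :+ v) :* v := (:- (con 1ℤ :+ v)) :* ((:- (con 1ℤ :+ v)) :+ con 1ℤ)) refl (+ n))) (ℤ.+≤+ ℕ.z≤n)
  where open +-*-Solver

module Bound (h : ℕ) (b : GR (suc (h ℕ.* 2))) where
  N : ℕ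
  N = suc (h ℕ.* 2)
  open GroupRing N

  -- For N = 2h + 1 and e the energy, h(h+1) - (Ne - e²) = (h - e)(h - e + 1), a product of
  -- consecutive integers. Here h(h+1) is (N² - 1)/4.
  normSum≤ : Binary N b → (1<N : 1 ℕ.< N) → Norms.normSum N 1<N b ℕ.≤ h ℕ.* suc h
  normSum≤ binary 1<N = ℤ.drop‿+≤+ (ℤ.0≤i-j⇒j≤i (subst (0ℤ ℤ.≤_) (begin
    (+ h ℤ.- e) ℤ.* (+ h ℤ.- e ℤ.+ 1ℤ)
      ≡⟨ solve 2 (λ h e → (h :- e) :* (h :- e :+ con 1ℤ) := h :* (con 1ℤ :+ h) :- ((con 1ℤ :+ h :* con (+ 2)) :* e :- e :* e)) refl (+ h) e ⟩
    + h ℤ.* (1ℤ ℤ.+ + h) ℤ.- ((1ℤ ℤ.+ + h ℤ.* + 2) ℤ.* e ℤ.- e ℤ.* e)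
      ≡⟨ cong₂ ℤ._-_ (sym (ℤ.pos-* h (suc h))) (cong₂ (λ x y → x ℤ.* e ℤ.- y) (cong (λ t → 1ℤ ℤ.+ t) (sym (ℤ.pos-* h 2))) (energy²≡sum² b binary)) ⟩
    + (h ℕ.* suc h) ℤ.- (+ N ℤ.* e ℤ.- sum b ℤ.* sum b)
      ≡⟨ cong (λ t → + (h ℕ.* suc h) ℤ.- t) (Norms.normSum-def N 1<N b) ⟨
    + (h ℕ.* suc h) ℤ.- + Norms.normSum N 1<N b ∎) (pronic-nonneg (+ h ℤ.- e))))
    where
    open +-*-Solver
    e = energy b

-- Square roots and rescaling

*-square-cancel-≤ : ∀ a c → a ℕ.* a ℕ.≤ c ℕ.* c → a ℕ.≤ c
*-square-cancel-≤ a c aa≤cc = ℕ.≮⇒≥ (λ c<a → ℕ.<⇒≱ (ℕ.*-mono-< c<a c<a) aa≤cc)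

^-double : ∀ x h → x ℕ.^ (h ℕ.* 2) ≡ x ℕ.^ h ℕ.* x ℕ.^ h
^-double x h = trans (sym (ℕ.^-*-assoc x h 2)) (cong (λ t → x ℕ.^ h ℕ.* t) (ℕ.*-identityʳ (x ℕ.^ h)))

^-distribʳ-* : ∀ h m n → (m ℕ.* n) ℕ.^ h ≡ m ℕ.^ h ℕ.* n ℕ.^ h
^-distribʳ-* zero    m n = refl
^-distribʳ-* (suc h) m n = trans (cong (λ t → m ℕ.* n ℕ.* t) (^-distribʳ-* h m n))
  (solve 4 (λ m n x y → m :* n :* (x :* y) := m :* x :* (n :* y)) refl m n (m ℕ.^ h) (n ℕ.^ h))
  where open ℕSolver.+-*-Solver

module Roots (h M : ℕ) where
  -- `lhs` and `rhs` are the square roots of the two sides of AM-GM for 2h terms with product M² and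
  -- sum at most h(h+1).
  lhs : ℕ
  lhs = (h ℕ.* 2) ℕ.^ h ℕ.* M
  rhs : ℕ
  rhs = (h ℕ.* suc h) ℕ.^ h

  lhs² : (h ℕ.* 2) ℕ.^ (h ℕ.* 2) ℕ.* (M ℕ.* M) ≡ lhs ℕ.* lhs
  lhs² = trans (cong (λ t → t ℕ.* (M ℕ.* M)) (^-double (h ℕ.* 2) h))
    (solve 2 (λ x M → x :* x :* (M :* M) := x :* M :* (x :* M)) refl ((h ℕ.* 2) ℕ.^ h) M)
    where open ℕSolver.+-*-Solver

  rhs² : (h ℕ.* suc h) ℕ.^ (h ℕ.* 2) ≡ rhs ℕ.* rhs
  rhs² = ^-double (h ℕ.* suc h) h

  -- The factor 2^h turns (2h)^h into h^h 4^h, and (h(h+1))^h into h^h (N+1)^h; cancelling h^h then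
  -- gives the bound of the theorem.
  scale-lhs : 2 ℕ.^ h ℕ.* lhs ≡ h ℕ.^ h ℕ.* (4 ℕ.^ h ℕ.* M)
  scale-lhs = trans (cong (λ t → 2 ℕ.^ h ℕ.* (t ℕ.* M)) (^-distribʳ-* h h 2)) (trans
    (solve 3 (λ x y M → y :* (x :* y :* M) := x :* (y :* y :* M)) refl (h ℕ.^ h) (2 ℕ.^ h) M)
    (cong (λ t → h ℕ.^ h ℕ.* (t ℕ.* M)) (sym (^-distribʳ-* h 2 2))))
    where open ℕSolver.+-*-Solver

  scale-rhs : 2 ℕ.^ h ℕ.* rhs ≡ h ℕ.^ h ℕ.* (suc (suc (h ℕ.* 2))) ℕ.^ h
  scale-rhs = trans (cong (λ t → 2 ℕ.^ h ℕ.* t) (^-distribʳ-* h h (suc h))) (trans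
    (solve 3 (λ x y z → y :* (x :* z) := x :* (z :* y)) refl (h ℕ.^ h) (2 ℕ.^ h) (suc h ℕ.^ h))
    (cong (λ t → h ℕ.^ h ℕ.* t) (sym (^-distribʳ-* h (suc h) 2))))
    where open ℕSolver.+-*-Solver

  lhs≤rhs⇒ : .{{_ : NonZero h}} → lhs ℕ.≤ rhs → 4 ℕ.^ h ℕ.* M ℕ.≤ (suc (suc (h ℕ.* 2))) ℕ.^ h
  lhs≤rhs⇒ lhs≤rhs = ℕ.*-cancelˡ-≤ (h ℕ.^ h) {{ℕ.m^n≢0 h h}}
    (subst₂ ℕ._≤_ scale-lhs scale-rhs (ℕ.*-monoʳ-≤ (2 ℕ.^ h) lhs≤rhs))

  ⇒lhs≡rhs : 4 ℕ.^ h ℕ.* M ≡ (suc (suc (h ℕ.* 2))) ℕ.^ h → lhs ≡ rhs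
  ⇒lhs≡rhs eq = ℕ.*-cancelˡ-≡ lhs rhs (2 ℕ.^ h) {{ℕ.m^n≢0 2 h}}
    (trans scale-lhs (trans (cong (λ t → h ℕ.^ h ℕ.* t) eq) (sym scale-rhs)))

-- Assembling the theorem

odd-prime-half : ∀ {N} → Prime N → N ≢ 2 → N ≡ suc (N ℕ./ 2 ℕ.* 2)
odd-prime-half {N} N-prime N≢2 with N % 2 in eq | m≡m%n+[m/n]*n N 2 | m%n<n N 2
... | 0 | _  | _ = [ (λ ()) , (λ 2≡N → contradiction (sym 2≡N) N≢2) ]′ (prime⇒irreducible N-prime (m%n≡0⇒n∣m N 2 eq))
... | 1 | d  | _ = d
... | suc (suc _) | _ | ℕ.s≤s (ℕ.s≤s ())

norm-bound : ∀ h → let N = suc (h ℕ.* 2) in Prime N → (b : GR N) → Binary N b → (m : ℤ) → IsNorm N b m →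
  4 ℕ.^ h ℕ.* ℤ.∣ m ∣ ℕ.≤ suc N ℕ.^ h × (4 ℕ.^ h ℕ.* ℤ.∣ m ∣ ≡ suc N ℕ.^ h → Perfect N b)
norm-bound zero N-prime = contradiction N-prime ¬prime[1]
norm-bound h@(suc g) N-prime b binary m norm≡m = lhs≤rhs⇒ lhs≤rhs , perfect
  where
  N : ℕ
  N = suc (h ℕ.* 2)
  1<N : 1 ℕ.< N
  1<N = ℕ.s≤s (ℕ.s≤s ℕ.z≤n)
  M = ℤ.∣ m ∣
  open Roots h M
  open GroupRing N
  open Norms N 1<N b
  open PositiveStarRingProperties (starRing 1<N) using (ν; module AMGM)

  tail : List ℕ
  tail = applyUpTo (2 ℕ.+_) (g ℕ.* 2)

  amgm-N : (h ℕ.* 2) ℕ.^ (h ℕ.* 2) ℕ.* (M ℕ.* M) ℕ.≤ normSum ℕ.^ (h ℕ.* 2)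
    × (.{{_ : NonZero normSum}} → normSum ℕ.^ (h ℕ.* 2) ℕ.≤ (h ℕ.* 2) ℕ.^ (h ℕ.* 2) ℕ.* (M ℕ.* M) →
       ν (h ℕ.* 2) ⊛ conjugateNorm 1 b ≈ ν normSum)
  amgm-N = subst (λ n → n ℕ.^ n ℕ.* (M ℕ.* M) ℕ.≤ normSum ℕ.^ n
      × (.{{_ : NonZero normSum}} → normSum ℕ.^ n ℕ.≤ n ℕ.^ n ℕ.* (M ℕ.* M) → ν n ⊛ conjugateNorm 1 b ≈ ν normSum))
    (length-applyUpTo id (h ℕ.* 2))
    -- As h ≥ 1, the list of indices unfolds to 0 ∷ 1 ∷ `tail`. Its head 0 stands for σ_1, so the
    -- equality case speaks about b itself.
    (AMGM.amgm-ν (λ j → σ N (suc j) b) 0 1 tail (sumNorms≈normSum N-prime) (productNorms≈square m norm≡m))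

  normSum^≤ : normSum ℕ.^ (h ℕ.* 2) ℕ.≤ rhs ℕ.* rhs
  normSum^≤ = subst (normSum ℕ.^ (h ℕ.* 2) ℕ.≤_) rhs² (ℕ.^-monoˡ-≤ (h ℕ.* 2) (Bound.normSum≤ h b binary 1<N))

  lhs≤rhs : lhs ℕ.≤ rhs
  lhs≤rhs = *-square-cancel-≤ lhs rhs (ℕ.≤-trans (ℕ.≤-reflexive (sym lhs²)) (ℕ.≤-trans (proj₁ amgm-N) normSum^≤))

  perfect : 4 ℕ.^ h ℕ.* M ≡ suc N ℕ.^ h → Perfect N b
  perfect eq = multiple-integral⇒perfect (h ℕ.* 2) normSum (proj₂ amgm-N {{normSum≢0}}
      (ℕ.≤-trans normSum^≤ (ℕ.≤-reflexive (sym (trans lhs² (cong₂ ℕ._*_ lhs≡rhs lhs≡rhs))))))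
    where
    lhs≡rhs : lhs ≡ rhs
    lhs≡rhs = ⇒lhs≡rhs eq
    rhs*rhs>0 : 0 ℕ.< rhs ℕ.* rhs
    rhs*rhs>0 = ℕ.>-nonZero⁻¹ (rhs ℕ.* rhs) {{ℕ.m*n≢0 rhs rhs {{ℕ.m^n≢0 (h ℕ.* suc h) h}} {{ℕ.m^n≢0 (h ℕ.* suc h) h}}}}
    normSum≢0 : NonZero normSum
    -- Otherwise AM-GM would give lhs² ≤ 0, although lhs² = rhs² > 0.
    normSum≢0 = ℕ.≢-nonZero (λ normSum≡0 → ℕ.<⇒≱ rhs*rhs>0 (ℕ.≤-trans
      (ℕ.≤-reflexive (sym (trans lhs² (cong₂ ℕ._*_ lhs≡rhs lhs≡rhs))))
      (ℕ.≤-trans (proj₁ amgm-N) (ℕ.≤-reflexive (cong (ℕ._^ (h ℕ.* 2)) normSum≡0)))))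

i≤+∣i∣ : ∀ i → i ℤ.≤ + ℤ.∣ i ∣
i≤+∣i∣ (+ n)      = ℤ.≤-refl
i≤+∣i∣ ℤ.-[1+ n ] = ℤ.-≤+

-- The bound for the absolute value of m dominates the one for m, and an equality with a natural
-- number persists under absolute values.
norm-boundℤ : ∀ {N} .{{_ : NonZero N}} h → N ≡ suc (h ℕ.* 2) → Prime N → (b : GR N) → Binary N b → (m : ℤ) → IsNorm N b m →
  + (4 ℕ.^ h) ℤ.* m ℤ.≤ + (suc N ℕ.^ h) × (+ (4 ℕ.^ h) ℤ.* m ≡ + (suc N ℕ.^ h) → Perfect N b)
norm-boundℤ h refl N-prime b binary m norm≡m =
  ℤ.≤-trans (ℤ.*-monoˡ-≤-nonNeg (+ (4 ℕ.^ h)) (i≤+∣i∣ m))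
    (ℤ.≤-trans (ℤ.≤-reflexive (sym (ℤ.pos-* (4 ℕ.^ h) ℤ.∣ m ∣))) (ℤ.+≤+ (proj₁ bound))) ,
  λ eq → proj₂ bound (trans (sym (ℤ.abs-* (+ (4 ℕ.^ h)) m)) (cong ℤ.∣_∣ eq))
  where
  bound : 4 ℕ.^ h ℕ.* ℤ.∣ m ∣ ℕ.≤ suc (suc (h ℕ.* 2)) ℕ.^ h
        × (4 ℕ.^ h ℕ.* ℤ.∣ m ∣ ≡ suc (suc (h ℕ.* 2)) ℕ.^ h → Perfect (suc (h ℕ.* 2)) b)
  bound = norm-bound h N-prime b binary m norm≡m

half-pred : ∀ {N} h → N ≡ suc (h ℕ.* 2) → (N ℕ.∸ 1) ℕ./ 2 ≡ h
half-pred h refl = m*n/n≡m h 2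

open import Data.Nat using (_∸_; _/_; _^_)
open import Data.Integer using (_*_; _≤_)

theorem2 : (N : ℕ) .{{_ : NonZero N}} → Prime N → N ≢ 2 →
    (b : GR N) → Coords N b → Binary N b →
    (m : ℤ) → IsNorm N b m →
    ((+ (4 ^ ((N ∸ 1) / 2))) * m ≤ + ((suc N) ^ ((N ∸ 1) / 2)))
    × ((+ (4 ^ ((N ∸ 1) / 2))) * m ≡ + ((suc N) ^ ((N ∸ 1) / 2)) → Perfect N b)
-- For odd N the quotients (N - 1)/2 and N/2 coincide, so h = N/2 is the required exponent.
theorem2 N N-prime N≢2 b _ binary m norm≡m rewrite half-pred (N / 2) (odd-prime-half N-prime N≢2) =
  norm-boundℤ (N / 2) (odd-prime-half N-prime N≢2) N-prime b binary m norm≡m
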